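{- Let $\mathbb F$ be an algebraically closed field of characteristic zero. Let $L:\mathbb F^n\to\mathbb F^m$ and $M:\mathbb F^r\to\mathbb F^m$ be polynomial maps with $\mathrm{im}(L)\subseteq\mathrm{im}(M)$. Let $\mathbf z=(z_1,\dots,z_n)$ be indeterminates. Then there exist $\mathbf c\in\mathbb F^n$ and formal power series $p_1(\mathbf z),\dots,p_r(\mathbf z)\in\mathbb F[[z_1,\dots,z_n]]$ such that $$L(\mathbf z+\mathbf c)=M(p_1(\mathbf z),\dots,p_r(\mathbf z))$$ as an equality in $\mathbb F[[z_1,\dots,z_n]]^m$.
   Context: A polynomial map $L=(L_1,\dots,L_m):\mathbb F^n\to\mathbb F^m$ is one whose components are polynomial functions. $\mathbb F[[z_1,\dots,z_n]]$ denotes the ring of formal power series around $\mathbf 0$; equality is coefficientwise. -}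

module Defs where

open import Level using (Level; _⊔_)
open import Algebra.Apartness.Bundles using (HeytingField; HeytingCommutativeRing)
open import Algebra.Bundles using (CommutativeRing)
open import Algebra.Bundles.Raw using (RawRing)
import Algebra.Definitions.RawSemiring as RawSemiringDefs
open import Data.Bool.Base using (if_then_else_)
open import Data.Fin.Base using (Fin; toℕ; fromℕ)
import Data.Nat as ℕ
open ℕ using (ℕ; suc)
open import Data.List.Base as List using (List; []; _∷_; upTo; cartesianProductWith)
open import Data.Product.Base using (_×_; _,_; ∃-syntax)
open import Data.Vec.Base as Vec using (Vec; []; _∷_; lookup; replicate; zipWith; _[_]≔_)
open import Data.Vec.Functional using (Vector)
open import Data.Vec.Properties using (≡-dec)
open import Function.Base using (id)
open import Relation.Nullary using (¬_; does)
open import Relation.Unary using (Pred)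

-- α represents the monomial x₁^α₁ ⋯ xₙ^αₙ.
MultiIndex : ℕ → Set
MultiIndex n = Vec ℕ n

-- The multi-indices β with β ≤ α componentwise, each listed once.
below : ∀ {n} → MultiIndex n → List (MultiIndex n)
below []      = [] ∷ []
below (k ∷ α) = cartesianProductWith _∷_ (upTo (suc k)) (below α)

-- A Heyting field is used because it is the library's notion of field.  Under
-- excluded middle, tightness makes x # y equivalent to ¬ (x ≈ y), so this is
-- then exactly a field in the usual sense (0# and 1# are apart because 1# - 0#
-- is invertible).
module _ {c ℓ₁ ℓ₂ : Level} (F : HeytingField c ℓ₁ ℓ₂) where

  private
    module F = HeytingField F

    fieldRawRing : RawRing c ℓ₁
    fieldRawRing =
      CommutativeRing.rawRing (HeytingCommutativeRing.commutativeRing F.heytingCommutativeRing)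

    module FOps = RawSemiringDefs (RawRing.rawSemiring fieldRawRing)

  CharacteristicZero : Set ℓ₁
  CharacteristicZero = ∀ (k : ℕ) → ¬ (suc k FOps.× F.1# F.≈ F.0#)

  -- a₀ + a₁ x + ⋯ + a_{d+1} x^{d+1} ranges over the polynomials of positive
  -- degree d + 1.
  AlgebraicallyClosed : Set (c ⊔ ℓ₁)
  AlgebraicallyClosed =
    ∀ (d : ℕ) (a : Vector F.Carrier (suc (suc d))) →
    ¬ (a (fromℕ (suc d)) F.≈ F.0#) →
    ∃[ x ] FOps.sum (λ i → a i F.* (x FOps.^ toℕ i)) F.≈ F.0#

  -- A finite formal sum of terms a · x^α; a multi-index may be repeated, in
  -- which case the coefficients add up.
  Polynomial : ℕ → Set c
  Polynomial n = List (F.Carrier × MultiIndex n)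

  -- Substitution into a ring A along a map ι from the field to A.  Only the raw
  -- operations of A matter for this.
  substitute : ∀ {a ℓ} (A : RawRing a ℓ) → (F.Carrier → RawRing.Carrier A) →
               ∀ {n} → Polynomial n → Vector (RawRing.Carrier A) n → RawRing.Carrier A
  substitute A ι []            x = RawRing.0# A
  substitute A ι ((a , α) ∷ P) x =
    (ι a A.* AOps.product (λ i → x i AOps.^ lookup α i)) A.+ substitute A ι P x
    where
    module A = RawRing A
    module AOps = RawSemiringDefs A.rawSemiring

  -- A polynomial map Fⁿ → Fᵐ, given by the polynomials defining its components.
  PolynomialMap : ℕ → ℕ → Set c
  PolynomialMap n m = Vector (Polynomial n) m

  apply : ∀ {n m} → PolynomialMap n m → Vector F.Carrier n → Vector F.Carrier m
  apply L x j = substitute fieldRawRing id (L j) x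

  im : ∀ {n m} → PolynomialMap n m → Pred (Vector F.Carrier m) (c ⊔ ℓ₁)
  im L y = ∃[ x ] (∀ j → apply L x j F.≈ y j)

  -- A formal power series is the family of its coefficients.
  PowerSeries : ℕ → Set c
  PowerSeries n = MultiIndex n → F.Carrier

  monomial : ∀ {n} → F.Carrier → MultiIndex n → PowerSeries n
  monomial a β α = if does (≡-dec ℕ._≟_ α β) then a else F.0#

  constant : ∀ {n} → F.Carrier → PowerSeries n
  constant {n} a = monomial a (replicate n 0)

  variable-series : ∀ {n} → Fin n → PowerSeries n
  variable-series {n} i = monomial F.1# (replicate n 0 [ i ]≔ 1)

  -- On β ≤ α the truncated difference zipWith _∸_ α β is the true one, so the
  -- product below is the Cauchy product.
  powerSeriesRawRing : ℕ → RawRing c ℓ₁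
  powerSeriesRawRing n = record
    { Carrier = PowerSeries n
    ; _≈_     = λ f g → ∀ α → f α F.≈ g α
    ; _+_     = λ f g α → f α F.+ g α
    ; _*_     = λ f g α →
        List.foldr F._+_ F.0# (List.map (λ β → f β F.* g (zipWith ℕ._∸_ α β)) (below α))
    ; -_      = λ f α → F.- f α
    ; 0#      = constant F.0#
    ; 1#      = constant F.1#
    }

  applySeries : ∀ {n m k} → PolynomialMap n m → Vector (PowerSeries k) n → Vector (PowerSeries k) m
  applySeries {k = k} L p j = substitute (powerSeriesRawRing k) constant (L j) p

  -- The tuple z + c of power series.
  translate : ∀ {n} → Vector F.Carrier n → Vector (PowerSeries n) n
  translate {n} c i = variable-series i + constant (c i)
    where open RawRing (powerSeriesRawRing n) using (_+_)

  _≈ₛ_ : ∀ {n m} → Vector (PowerSeries n) m → Vector (PowerSeries n) m → Set ℓ₁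
  _≈ₛ_ {n} f g = ∀ j → f j ≈ g j
    where open RawRing (powerSeriesRawRing n) using (_≈_)

{-# OPTIONS --safe #-}
-- For a domain R over F call a family of F-algebra maps from R to the formal
-- power series dense if each nonzero element of R is sent to a unit by one of
-- them.  Starting from R = F[z], with the Taylor expansions at the points of Fⁿ,
-- adjoin to R values for the unknowns of M(y) = L(z), one at a time, so that the
-- system stays solvable at generic F-points of R and the maps stay dense:
-- either the next unknown y is constrained by no nonzero polynomial over R, and
-- R[y] will do, or there is a polynomial h of least degree such that the system
-- together with h(y) = 0 is solvable at generic points.  Minimality makes h
-- irreducible over the fraction field of R, so R[y]/(h), taken up to powers of
-- the leading coefficient of h, is again a domain.  In characteristic zero h has
-- generically simple roots, which Hensel's lemma lifts to power series; hence
-- density persists.  Once all unknowns are adjoined the equations hold in R, and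
-- any of the maps turns them into the required identity of power series.
module Submission where

-- Generic solvability means no more than that the points with a solution are Zariski dense: no
-- nonzero ρ rules out solutions wherever it does not vanish. This is weaker than the openness that
-- Chevalley's theorem provides, but the enlarged ring inherits it from the minimality of h alone,
-- so elimination theory is avoided. Irreducibility is likewise tested at points, and no fraction
-- field has to be built.
--
-- The centre c cannot be fixed in advance: leading coefficients, and the Bezout constants that
-- certify simple roots, must not vanish there, and they arise only as unknowns are adjoined. Hence
-- density is carried for all elements at once; since R is a domain, the finitely many conditions of
-- one step merge into a single product. The germ is chosen in the last ring and then restricted to
-- the earlier ones.
--
-- As R is not a field, division is possible only up to nonzero factors, so powers of leading
-- coefficients accompany the identities.

open import Defs
open import Level using (_⊔_)
open import Algebra.Apartness.Bundles using (HeytingField)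
open import Axiom.ExcludedMiddle using (ExcludedMiddle)
open import Data.Nat.Base using (ℕ)
open import Data.Product.Base using (Σ-syntax)
open import Data.Vec.Functional using (Vector)
open import Relation.Unary using (_⊆_)

open import Algebra.Apartness.Bundles using (HeytingCommutativeRing)
open import Algebra.Bundles using (CommutativeRing)
open import Algebra.Bundles.Raw using (RawRing)
import Algebra.Construct.Pointwise as Pointwise
import Algebra.Definitions.RawSemiring as RawSemiringDefs
open import Algebra.Morphism.Bundles using (RingHomomorphism)
import Algebra.Morphism.Construct.Composition as Composition
import Algebra.Morphism.Construct.Identity as Identity
import Algebra.Morphism.RingMonomorphism as RingMonomorphism
open import Algebra.Morphism.Structures using (IsRingMonomorphism)
import Algebra.Properties.AbelianGroup as AbelianGroupProperties
import Algebra.Properties.CommutativeSemigroup as CommutativeSemigroupProperties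
import Algebra.Properties.Ring as RingProperties
import Algebra.Properties.Semiring.Exp as Exp
import Algebra.Properties.Semiring.Mult as Mult
import Algebra.Properties.Semiring.Sum as Sums
import Algebra.Solver.Ring
import Algebra.Solver.Ring.AlmostCommutativeRing as ACR
open import Data.Empty using (⊥-elim)
open import Data.Fin.Base using (Fin; zero; suc; toℕ)
import Data.Fin.Properties as Fin
open import Data.List.Base as List using (List; []; _∷_)
open import Data.List.Properties using (map-++; map-∘)
open import Data.Maybe.Base as Maybe using (Maybe; just; nothing)
open import Data.Nat.Base as ℕ using (zero; suc; _≤_; _<_; z≤n; s≤s; s≤s⁻¹; _≤′_; ≤′-refl; ≤′-step)
import Data.Nat.Properties as ℕ
open import Data.Product.Base using (_×_; _,_; proj₁; proj₂; ∃-syntax)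
open import Data.Sum.Base as Sum using (_⊎_; inj₁; inj₂)
import Data.Vec.Base as Vec
import Data.Vec.Functional as Vector
open import Function.Base using (_∘_; id)
open import Level using (Lift; lift; lower) renaming (suc to lsuc)
open import Relation.Binary.Definitions using (Decidable)
open import Relation.Binary.PropositionalEquality as ≡ using (_≡_)
import Relation.Binary.Reasoning.Setoid as SetoidReasoning
open import Relation.Nullary using (¬_; Dec; yes; no)
open import Relation.Nullary.Decidable using (map′)

-- The coefficient (m , n) stands for the integer m - n; unlike the elements of
-- R, these can be compared, so the solver cancels.
module Solver {c ℓ} (R : CommutativeRing c ℓ) where
  open CommutativeRing R
  open RingProperties ring using (-‿distribˡ-*; -‿distribʳ-*; -‿involutive; -0#≈0#)
  open AbelianGroupProperties +-abelianGroup using (⁻¹-∙-comm)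
  open CommutativeSemigroupProperties +-commutativeSemigroup using (interchange)
  open Mult semiring renaming (_×_ to _·_)
  open SetoidReasoning setoid

  differences : RawRing _ _
  differences = record
    { Carrier = ℕ × ℕ
    ; _≈_     = _≡_
    ; _+_     = λ (m , n) (p , q) → m ℕ.+ p , n ℕ.+ q
    ; _*_     = λ (m , n) (p , q) → m ℕ.* p ℕ.+ n ℕ.* q , m ℕ.* q ℕ.+ n ℕ.* p
    ; -_      = λ (m , n) → n , m
    ; 0#      = 0 , 0
    ; 1#      = 1 , 0
    }

  value : ℕ × ℕ → Carrier
  value (m , n) = m · 1# - n · 1#

  value-+ : ∀ m n p q → value (m ℕ.+ p , n ℕ.+ q) ≈ value (m , n) + value (p , q)
  value-+ m n p q = begin
    (m ℕ.+ p) · 1# - (n ℕ.+ q) · 1#                  ≈⟨ +-cong (×-homo-+ 1# m p) (-‿cong (×-homo-+ 1# n q)) ⟩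
    (m · 1# + p · 1#) - (n · 1# + q · 1#)            ≈⟨ +-congˡ (⁻¹-∙-comm _ _) ⟨
    (m · 1# + p · 1#) + (- (n · 1#) + - (q · 1#))    ≈⟨ interchange _ _ _ _ ⟩
    (m · 1# - n · 1#) + (p · 1# - q · 1#)            ∎

  value-neg : ∀ m n → value (n , m) ≈ - value (m , n)
  value-neg m n = begin
    n · 1# - m · 1#          ≈⟨ +-comm _ _ ⟩
    - (m · 1#) + n · 1#      ≈⟨ +-congˡ (-‿involutive _) ⟨
    - (m · 1#) - - (n · 1#)  ≈⟨ ⁻¹-∙-comm _ _ ⟩
    - (m · 1# - n · 1#)      ∎

  value-scale : ∀ m p q → value (m ℕ.* p , m ℕ.* q) ≈ (m · 1#) * value (p , q)
  value-scale m p q = begin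
    (m ℕ.* p) · 1# - (m ℕ.* q) · 1#                    ≈⟨ +-cong (×1-homo-* m p) (-‿cong (×1-homo-* m q)) ⟩
    (m · 1#) * (p · 1#) - (m · 1#) * (q · 1#)          ≈⟨ +-congˡ (-‿distribʳ-* _ _) ⟩
    (m · 1#) * (p · 1#) + (m · 1#) * (- (q · 1#))      ≈⟨ distribˡ _ _ _ ⟨
    (m · 1#) * (p · 1# - q · 1#)                       ∎

  value-* : ∀ m n p q → value (m ℕ.* p ℕ.+ n ℕ.* q , m ℕ.* q ℕ.+ n ℕ.* p) ≈ value (m , n) * value (p , q)
  value-* m n p q = begin
    value (m ℕ.* p ℕ.+ n ℕ.* q , m ℕ.* q ℕ.+ n ℕ.* p)                ≈⟨ value-+ (m ℕ.* p) (m ℕ.* q) (n ℕ.* q) (n ℕ.* p) ⟩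
    value (m ℕ.* p , m ℕ.* q) + value (n ℕ.* q , n ℕ.* p)            ≈⟨ +-cong (value-scale m p q) (value-scale n q p) ⟩
    (m · 1#) * value (p , q) + (n · 1#) * value (q , p)              ≈⟨ +-congˡ (*-congˡ (value-neg p q)) ⟩
    (m · 1#) * value (p , q) + (n · 1#) * (- value (p , q))          ≈⟨ +-congˡ (trans (sym (-‿distribʳ-* _ _)) (-‿distribˡ-* _ _)) ⟩
    (m · 1#) * value (p , q) + (- (n · 1#)) * value (p , q)          ≈⟨ distribʳ _ _ _ ⟨
    value (m , n) * value (p , q)                                    ∎

  almostCommutativeRing : ACR.AlmostCommutativeRing c ℓ
  almostCommutativeRing = ACR.fromCommutativeRing R

  -- Agrees with value, but makes the constants 0# and 1# literal in solver goals.
  constant′ : ℕ × ℕ → Carrier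
  constant′ (0 , 0) = 0#
  constant′ (1 , 0) = 1#
  constant′ x       = value x

  constant′≈value : ∀ x → constant′ x ≈ value x
  constant′≈value (0           , 0)     = sym (-‿inverseʳ 0#)
  constant′≈value (1           , 0)     = sym (trans (+-cong (+-identityʳ 1#) -0#≈0#) (+-identityʳ 1#))
  constant′≈value (0           , suc _) = refl
  constant′≈value (1           , suc _) = refl
  constant′≈value (suc (suc _) , _)     = refl

  morphism : differences ACR.-Raw-AlmostCommutative⟶ almostCommutativeRing
  morphism = record
    { ⟦_⟧    = constant′
    ; +-homo = λ x@(m , n) y@(p , q) → trans (constant′≈value (m ℕ.+ p , n ℕ.+ q))
        (trans (value-+ m n p q) (sym (+-cong (constant′≈value x) (constant′≈value y))))
    ; *-homo = λ x@(m , n) y@(p , q) → trans (constant′≈value (m ℕ.* p ℕ.+ n ℕ.* q , m ℕ.* q ℕ.+ n ℕ.* p))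
        (trans (value-* m n p q) (sym (*-cong (constant′≈value x) (constant′≈value y))))
    ; -‿homo = λ x@(m , n) → trans (constant′≈value (n , m)) (trans (value-neg m n) (-‿cong (sym (constant′≈value x))))
    ; 0-homo = refl
    ; 1-homo = refl
    }

  -- Pairs are compared as integers. Distinct integers may still have equal values in R, so a failed
  -- comparison decides nothing.
  value-≟ : ∀ x y → Maybe (value x ≈ value y)
  value-≟ (m , n) (p , q) with (m ℕ.+ q) ℕ.≟ (p ℕ.+ n)
  ... | no  _ = nothing
  ... | yes e = just (begin
    m · 1# - n · 1#                                              ≈⟨ +-identityʳ _ ⟨
    (m · 1# - n · 1#) + 0#                                       ≈⟨ +-congˡ (-‿inverseʳ _) ⟨
    (m · 1# - n · 1#) + (q · 1# - q · 1#)                        ≈⟨ value-+ m n q q ⟨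
    value (m ℕ.+ q , n ℕ.+ q)                                    ≡⟨ ≡.cong value (≡.cong₂ _,_ e (ℕ.+-comm n q)) ⟩
    value (p ℕ.+ n , q ℕ.+ n)                                    ≈⟨ value-+ p q n n ⟩
    (p · 1# - q · 1#) + (n · 1# - n · 1#)                        ≈⟨ +-congˡ (-‿inverseʳ _) ⟩
    (p · 1# - q · 1#) + 0#                                       ≈⟨ +-identityʳ _ ⟩
    p · 1# - q · 1#                                              ∎)

  constant′-≟ : ∀ x y → Maybe (constant′ x ≈ constant′ y)
  constant′-≟ x y = Maybe.map (λ e → trans (constant′≈value x) (trans e (sym (constant′≈value y)))) (value-≟ x y)

  open Algebra.Solver.Ring differences almostCommutativeRing morphism constant′-≟ public
    using (solve; _:=_; _:+_; _:*_; _:-_; :-_; con)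

-- Ring homomorphisms

identityHom : ∀ {a ℓ} (A : CommutativeRing a ℓ) → RingHomomorphism (CommutativeRing.rawRing A) (CommutativeRing.rawRing A)
identityHom A = record { ⟦_⟧ = id ; isRingHomomorphism = Identity.isRingHomomorphism A.rawRing A.refl }
  where module A = CommutativeRing A

compose : ∀ {a ℓ₁ b ℓ₂ c ℓ₃} {A : RawRing a ℓ₁} {B : RawRing b ℓ₂} (C : CommutativeRing c ℓ₃) →
          RingHomomorphism A B → RingHomomorphism B (CommutativeRing.rawRing C) → RingHomomorphism A (CommutativeRing.rawRing C)
compose C f g = record
  { ⟦_⟧                = λ x → g.⟦ f.⟦ x ⟧ ⟧
  ; isRingHomomorphism = Composition.isRingHomomorphism (CommutativeRing.trans C) f.isRingHomomorphism g.isRingHomomorphism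
  }
  where
  module f = RingHomomorphism f
  module g = RingHomomorphism g

module _ {a ℓ₁ b ℓ₂} (A : CommutativeRing a ℓ₁) (B : CommutativeRing b ℓ₂) where
  private
    module A = CommutativeRing A
    module B = CommutativeRing B
  open RingProperties B.ring using (+-cancelʳ; +-inverseʳ-unique)
  open SetoidReasoning B.setoid

  -- Zero and negatives are preserved by cancellation in the additive group, so only sums, products
  -- and 1 are asked for.
  ringHomomorphism : (f : A.Carrier → B.Carrier) → (∀ {x y} → x A.≈ y → f x B.≈ f y) →
                     (∀ x y → f (x A.+ y) B.≈ f x B.+ f y) →
                     (∀ x y → f (x A.* y) B.≈ f x B.* f y) →
                     f A.1# B.≈ B.1# → RingHomomorphism A.rawRing B.rawRing
  ringHomomorphism f f-cong f-+ f-* f-1 = record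
    { ⟦_⟧ = f
    ; isRingHomomorphism = record
      { isSemiringHomomorphism = record
        { isNearSemiringHomomorphism = record
          { +-isMonoidHomomorphism = record
            { isMagmaHomomorphism = record
              { isRelHomomorphism = record { cong = f-cong } ; homo = f-+ }
            ; ε-homo = f-0
            }
          ; *-homo = f-*
          }
        ; 1#-homo = f-1
        }
      ; -‿homo = λ x → +-inverseʳ-unique (f x) (f (A.- x)) (begin
          f x B.+ f (A.- x)  ≈⟨ f-+ x (A.- x) ⟨
          f (x A.+ A.- x)    ≈⟨ f-cong (A.-‿inverseʳ x) ⟩
          f A.0#             ≈⟨ f-0 ⟩
          B.0#               ∎)
      }
    }
    where
    f-0 : f A.0# B.≈ B.0#
    f-0 = +-cancelʳ (f A.0#) (f A.0#) B.0# (begin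
      f A.0# B.+ f A.0#    ≈⟨ f-+ A.0# A.0# ⟨
      f (A.0# A.+ A.0#)    ≈⟨ f-cong (A.+-identityˡ A.0#) ⟩
      f A.0#               ≈⟨ B.+-identityˡ _ ⟨
      B.0# B.+ f A.0#      ∎)

-- Formal power series in one variable

module Series {c ℓ} (R : CommutativeRing c ℓ) where
  open CommutativeRing R
  open CommutativeSemigroupProperties +-commutativeSemigroup using (interchange; x∙yz≈y∙xz)
  open SetoidReasoning setoid

  infix 4 _≋_
  infixl 7 _⊛_

  _≋_ : (f g : ℕ → Carrier) → Set ℓ
  f ≋ g = ∀ k → f k ≈ g k

  -- The Cauchy product through f = f 0 + x f′ with f′ = `f ∘ suc`. In this form the ring laws are
  -- inductions on the degree, without reindexing of finite sums.
  _⊛_ : (f g : ℕ → Carrier) → ℕ → Carrier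
  (f ⊛ g) zero    = f 0 * g 0
  (f ⊛ g) (suc k) = f 0 * g (suc k) + (f ∘ suc ⊛ g) k

  embed : Carrier → ℕ → Carrier
  embed a zero    = a
  embed a (suc _) = 0#

  ⊛-cong : ∀ {f f′ g g′} → f ≋ f′ → g ≋ g′ → f ⊛ g ≋ f′ ⊛ g′
  ⊛-cong p q zero    = *-cong (p 0) (q 0)
  ⊛-cong p q (suc k) = +-cong (*-cong (p 0) (q (suc k))) (⊛-cong (p ∘ suc) q k)

  ⊛-distribʳ : ∀ f g h → (λ k → g k + h k) ⊛ f ≋ λ k → (g ⊛ f) k + (h ⊛ f) k
  ⊛-distribʳ f g h zero    = distribʳ _ _ _
  ⊛-distribʳ f g h (suc k) = begin
    (g 0 + h 0) * f (suc k) + ((λ i → g (suc i) + h (suc i)) ⊛ f) k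
      ≈⟨ +-cong (distribʳ _ _ _) (⊛-distribʳ f (g ∘ suc) (h ∘ suc) k) ⟩
    (g 0 * f (suc k) + h 0 * f (suc k)) + ((g ∘ suc ⊛ f) k + (h ∘ suc ⊛ f) k)
      ≈⟨ interchange _ _ _ _ ⟩
    (g ⊛ f) (suc k) + (h ⊛ f) (suc k) ∎

  -- The mirror image of the defining recursion, splitting g instead of f; commutativity rests on
  -- it.
  ⊛-suc : ∀ f g k → (f ⊛ g) (suc k) ≈ f (suc k) * g 0 + (f ⊛ g ∘ suc) k
  ⊛-suc f g zero    = +-comm _ _
  ⊛-suc f g (suc k) = begin
    f 0 * g (2 ℕ.+ k) + (f ∘ suc ⊛ g) (suc k)                              ≈⟨ +-congˡ (⊛-suc (f ∘ suc) g k) ⟩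
    f 0 * g (2 ℕ.+ k) + (f (2 ℕ.+ k) * g 0 + (f ∘ suc ⊛ g ∘ suc) k)        ≈⟨ x∙yz≈y∙xz _ _ _ ⟩
    f (2 ℕ.+ k) * g 0 + (f ⊛ g ∘ suc) (suc k)                              ∎

  ⊛-comm : ∀ f g → f ⊛ g ≋ g ⊛ f
  ⊛-comm f g zero    = *-comm _ _
  ⊛-comm f g (suc k) = begin
    f 0 * g (suc k) + (f ∘ suc ⊛ g) k  ≈⟨ +-cong (*-comm _ _) (⊛-comm (f ∘ suc) g k) ⟩
    g (suc k) * f 0 + (g ⊛ f ∘ suc) k  ≈⟨ ⊛-suc g f k ⟨
    (g ⊛ f) (suc k)                    ∎

  ⊛-scale : ∀ a f g → (λ k → a * f k) ⊛ g ≋ λ k → a * (f ⊛ g) k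
  ⊛-scale a f g zero    = *-assoc _ _ _
  ⊛-scale a f g (suc k) = begin
    a * f 0 * g (suc k) + ((λ i → a * f (suc i)) ⊛ g) k  ≈⟨ +-cong (*-assoc _ _ _) (⊛-scale a (f ∘ suc) g k) ⟩
    a * (f 0 * g (suc k)) + a * (f ∘ suc ⊛ g) k          ≈⟨ distribˡ _ _ _ ⟨
    a * (f ⊛ g) (suc k)                                  ∎

  ⊛-assoc : ∀ f g h → (f ⊛ g) ⊛ h ≋ f ⊛ (g ⊛ h)
  ⊛-assoc f g h zero    = *-assoc _ _ _
  ⊛-assoc f g h (suc k) = begin
    f 0 * g 0 * h (suc k) + ((λ i → f 0 * g (suc i) + (f ∘ suc ⊛ g) i) ⊛ h) k
      ≈⟨ +-cong (*-assoc _ _ _) (⊛-distribʳ h _ _ k) ⟩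
    f 0 * (g 0 * h (suc k)) + (((λ i → f 0 * g (suc i)) ⊛ h) k + ((f ∘ suc ⊛ g) ⊛ h) k)
      ≈⟨ +-congˡ (+-cong (⊛-scale (f 0) (g ∘ suc) h k) (⊛-assoc (f ∘ suc) g h k)) ⟩
    f 0 * (g 0 * h (suc k)) + (f 0 * (g ∘ suc ⊛ h) k + (f ∘ suc ⊛ (g ⊛ h)) k)
      ≈⟨ +-assoc _ _ _ ⟨
    (f 0 * (g 0 * h (suc k)) + f 0 * (g ∘ suc ⊛ h) k) + (f ∘ suc ⊛ (g ⊛ h)) k
      ≈⟨ +-congʳ (distribˡ _ _ _) ⟨
    (f ⊛ (g ⊛ h)) (suc k) ∎

  ⊛-zeroˡ : ∀ g → (λ _ → 0#) ⊛ g ≋ λ _ → 0#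
  ⊛-zeroˡ g zero    = zeroˡ _
  ⊛-zeroˡ g (suc k) = trans (+-cong (zeroˡ _) (⊛-zeroˡ g k)) (+-identityˡ _)

  embed-⊛ : ∀ a g → embed a ⊛ g ≋ λ k → a * g k
  embed-⊛ a g zero    = refl
  embed-⊛ a g (suc k) = trans (+-congˡ (⊛-zeroˡ g k)) (+-identityʳ _)

  ⊛-identityˡ : ∀ g → embed 1# ⊛ g ≋ g
  ⊛-identityˡ g k = trans (embed-⊛ 1# g k) (*-identityˡ _)

  seriesRing : CommutativeRing c ℓ
  seriesRing = record
    { Carrier = ℕ → Carrier
    ; _≈_     = _≋_
    ; _+_     = λ f g k → f k + g k
    ; _*_     = _⊛_
    ; -_      = λ f k → - f k
    ; 0#      = λ _ → 0#
    ; 1#      = embed 1#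
    ; isCommutativeRing = record
      { isRing = record
        { +-isAbelianGroup = Pointwise.isAbelianGroup ℕ +-isAbelianGroup
        ; *-cong     = ⊛-cong
        ; *-assoc    = ⊛-assoc
        ; *-identity = ⊛-identityˡ , λ g k → trans (⊛-comm g (embed 1#) k) (⊛-identityˡ g k)
        ; distrib    = (λ f g h k → begin
            (f ⊛ (λ i → g i + h i)) k    ≈⟨ ⊛-comm f _ k ⟩
            ((λ i → g i + h i) ⊛ f) k    ≈⟨ ⊛-distribʳ f g h k ⟩
            (g ⊛ f) k + (h ⊛ f) k        ≈⟨ +-cong (⊛-comm g f k) (⊛-comm h f k) ⟩
            (f ⊛ g) k + (f ⊛ h) k        ∎) , ⊛-distribʳ
        }
      ; *-comm = ⊛-comm
      }
    }

  embedding : RingHomomorphism rawRing (CommutativeRing.rawRing seriesRing)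
  embedding = ringHomomorphism R seriesRing embed
    (λ { e zero → e ; e (suc k) → refl })
    (λ { a b zero → refl ; a b (suc k) → sym (+-identityˡ 0#) })
    (λ { a b zero → refl ; a b (suc k) → sym (trans (embed-⊛ a (embed b) (suc k)) (zeroʳ a)) })
    (λ k → refl)

  constantTerm : RingHomomorphism (CommutativeRing.rawRing seriesRing) rawRing
  constantTerm = ringHomomorphism seriesRing R (λ f → f 0) (λ e → e 0) (λ _ _ → refl) (λ _ _ → refl) refl

  ⊛-vanishes : ∀ f g n → (∀ i → i ≤ n → f i ≈ 0#) → (f ⊛ g) n ≈ 0#
  ⊛-vanishes f g zero    f≈0 = trans (*-congʳ (f≈0 0 z≤n)) (zeroˡ _)
  ⊛-vanishes f g (suc n) f≈0 = trans
    (+-cong (trans (*-congʳ (f≈0 0 z≤n)) (zeroˡ _)) (⊛-vanishes (f ∘ suc) g n (λ i i≤n → f≈0 (suc i) (s≤s i≤n))))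
    (+-identityˡ 0#)

  -- Orders add: order at least n times order at least 1. This is the one coefficient of accuracy
  -- that a Newton step gains.
  ⊛-vanishes-next : ∀ f g n → (∀ i → i < n → f i ≈ 0#) → g 0 ≈ 0# → (f ⊛ g) n ≈ 0#
  ⊛-vanishes-next f g zero    f≈0 g₀≈0 = trans (*-congˡ g₀≈0) (zeroʳ _)
  ⊛-vanishes-next f g (suc n) f≈0 g₀≈0 = trans
    (+-cong (trans (*-congʳ (f≈0 0 (s≤s z≤n))) (zeroˡ _))
            (⊛-vanishes-next (f ∘ suc) g n (λ i i<n → f≈0 (suc i) (s≤s i<n)) g₀≈0))
    (+-identityˡ 0#)

-- Hensel's lemma

module Evaluation {c ℓ} (T : CommutativeRing c ℓ) where
  open CommutativeRing T
  open SetoidReasoning setoid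
  open Solver T

  telescope : ∀ x y → x ≈ y + (x - y)
  telescope = solve 2 (λ x y → x := y :+ (x :- y)) refl

  module _ {a} {A : Set a} (φ : A → Carrier) where

    -- Coefficients are read through `φ`, so that one list is a polynomial over a domain and over
    -- every ring to which the domain is mapped.
    eval : Carrier → List A → Carrier
    eval y []      = 0#
    eval y (a ∷ f) = φ a + y * eval y f

    -- The polynomial (f(y) - f(w)) / (y - w), so that f′(y) = quotient y y f.
    quotient : Carrier → Carrier → List A → Carrier
    quotient y w []      = 0#
    quotient y w (a ∷ f) = eval y f + w * quotient y w f

    eval-difference : ∀ y w f → eval y f - eval w f ≈ (y - w) * quotient y w f
    eval-difference y w []      = solve 2 (λ y w → con (0 , 0) :- con (0 , 0) := (y :- w) :* con (0 , 0)) refl y w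
    eval-difference y w (a ∷ f) = begin
      (φ a + y * eval y f) - (φ a + w * eval w f)
        ≈⟨ solve 5 (λ a y w p q → (a :+ y :* p) :- (a :+ w :* q) := (y :- w) :* p :+ w :* (p :- q)) refl (φ a) y w (eval y f) (eval w f) ⟩
      (y - w) * eval y f + w * (eval y f - eval w f)
        ≈⟨ +-congˡ (*-congˡ (eval-difference y w f)) ⟩
      (y - w) * eval y f + w * ((y - w) * quotient y w f)
        ≈⟨ solve 4 (λ d w p q → d :* p :+ w :* (d :* q) := d :* (p :+ w :* q)) refl (y - w) w (eval y f) (quotient y w f) ⟩
      (y - w) * quotient y w (a ∷ f) ∎

    -- This replaces Taylor's formula: with the divided difference in place of the derivative the
    -- factorisation is exact, and there is no second-order remainder to estimate.
    eval-newton : ∀ u y f → let y′ = y - u * eval y f in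
                  eval y′ f ≈ eval y f * (1# - u * quotient y′ y f)
    eval-newton u y f = begin
      eval y′ f
        ≈⟨ telescope (eval y′ f) (eval y f) ⟩
      eval y f + (eval y′ f - eval y f)
        ≈⟨ +-congˡ (eval-difference y′ y f) ⟩
      eval y f + (y′ - y) * quotient y′ y f
        ≈⟨ solve 4 (λ y u e q → e :+ ((y :- u :* e) :- y) :* q := e :* (con (1 , 0) :- u :* q)) refl y u (eval y f) (quotient y′ y f) ⟩
      eval y f * (1# - u * quotient y′ y f) ∎
      where y′ = y - u * eval y f

    eval-congˡ : ∀ {y y′} f → y ≈ y′ → eval y f ≈ eval y′ f
    eval-congˡ []      e = refl
    eval-congˡ (a ∷ f) e = +-congˡ (*-cong e (eval-congˡ f e))

    quotient-congˡ : ∀ {y y′ w w′} f → y ≈ y′ → w ≈ w′ → quotient y w f ≈ quotient y′ w′ f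
    quotient-congˡ []      e e′ = refl
    quotient-congˡ (a ∷ f) e e′ = +-cong (eval-congˡ f e) (*-cong e′ (quotient-congˡ f e e′))

module _ {c ℓ c′ ℓ′} {T : CommutativeRing c ℓ} {T′ : CommutativeRing c′ ℓ′}
         (g : RingHomomorphism (CommutativeRing.rawRing T) (CommutativeRing.rawRing T′)) where
  private
    module T = CommutativeRing T
    module T′ = CommutativeRing T′
    module E = Evaluation T
    module E′ = Evaluation T′
  open RingHomomorphism g

  module _ {a} {A : Set a} (φ : A → T.Carrier) where
    eval-homo : ∀ y f → ⟦ E.eval φ y f ⟧ T′.≈ E′.eval (⟦_⟧ ∘ φ) ⟦ y ⟧ f
    eval-homo y []      = 0#-homo
    eval-homo y (a ∷ f) = T′.trans (+-homo _ _) (T′.+-congˡ (T′.trans (*-homo _ _) (T′.*-congˡ (eval-homo y f))))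

    quotient-homo : ∀ y w f → ⟦ E.quotient φ y w f ⟧ T′.≈ E′.quotient (⟦_⟧ ∘ φ) ⟦ y ⟧ ⟦ w ⟧ f
    quotient-homo y w []      = 0#-homo
    quotient-homo y w (a ∷ f) = T′.trans (+-homo _ _) (T′.+-cong (eval-homo y f) (T′.trans (*-homo _ _) (T′.*-congˡ (quotient-homo y w f))))

Invertible₀ : ∀ {c ℓ} → CommutativeRing c ℓ → Set _
Invertible₀ F = ∀ x → ¬ (x ≈ 0#) → ∃[ u ] x * u ≈ 1#
  where open CommutativeRing F

module Hensel {c ℓ} (F : CommutativeRing c ℓ) (inverse : Invertible₀ F) where
  private
    module F = CommutativeRing F
    module EF = Evaluation F

  -- Simple roots lift along the residue map. The polynomial need not be monic, which is what makes
  -- elements of nonzero residue invertible, through a y - 1.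
  Henselian : (P : CommutativeRing c ℓ) → RingHomomorphism (CommutativeRing.rawRing P) F.rawRing → Set (lsuc c ⊔ ℓ)
  Henselian P ε =
    ∀ {A : Set c} (φ : A → P.Carrier) (f : List A) (y₀ : F.Carrier) →
    EF.eval (⟦_⟧ ∘ φ) y₀ f F.≈ F.0# → ¬ (EF.quotient (⟦_⟧ ∘ φ) y₀ y₀ f F.≈ F.0#) →
    ∃[ y ] EP.eval φ y f P.≈ P.0# × ⟦ y ⟧ F.≈ y₀
    where
    module P = CommutativeRing P
    module EP = Evaluation P
    open RingHomomorphism ε

  henselian-field : Henselian F (identityHom F)
  henselian-field φ f y₀ root _ = y₀ , root , F.refl

  module _ {P : CommutativeRing c ℓ} {ε : RingHomomorphism (CommutativeRing.rawRing P) F.rawRing}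
           (henselian : Henselian P ε) where
    private
      module P = CommutativeRing P
      module EP = Evaluation P
    open RingHomomorphism ε using (⟦_⟧)
    module ε = RingHomomorphism ε

    -- The inverse of a is the root of a y - 1.
    invertible : ∀ a → ¬ (⟦ a ⟧ F.≈ F.0#) → ∃[ u ] a P.* u P.≈ P.1#
    invertible a a≉0 with inverse ⟦ a ⟧ a≉0
    ... | u₀ , au₀≈1 with henselian id (P.- P.1# ∷ a ∷ []) u₀ root simple
      where
      open SetoidReasoning F.setoid
      open Solver F
      root : EF.eval ⟦_⟧ u₀ (P.- P.1# ∷ a ∷ []) F.≈ F.0#
      root = begin
        ⟦ P.- P.1# ⟧ F.+ u₀ F.* (⟦ a ⟧ F.+ u₀ F.* F.0#)  ≈⟨ F.+-congʳ (F.trans (ε.-‿homo _) (F.-‿cong ε.1#-homo)) ⟩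
        F.- F.1# F.+ u₀ F.* (⟦ a ⟧ F.+ u₀ F.* F.0#)      ≈⟨ solve 2 (λ a u → :- con (1 , 0) :+ u :* (a :+ u :* con (0 , 0)) := :- con (1 , 0) :+ a :* u) F.refl ⟦ a ⟧ u₀ ⟩
        F.- F.1# F.+ ⟦ a ⟧ F.* u₀                        ≈⟨ F.+-congˡ au₀≈1 ⟩
        F.- F.1# F.+ F.1#                                ≈⟨ F.-‿inverseˡ _ ⟩
        F.0#                                             ∎
      simple : ¬ (EF.quotient ⟦_⟧ u₀ u₀ (P.- P.1# ∷ a ∷ []) F.≈ F.0#)
      simple e = a≉0 (F.trans (solve 2 (λ a u → a := (a :+ u :* con (0 , 0)) :+ u :* (con (0 , 0) :+ u :* con (0 , 0))) F.refl ⟦ a ⟧ u₀) e)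
    ... | u , e , _ = u , (begin
      a P.* u                                                  ≈⟨ solve 2 (λ a u → a :* u := con (1 , 0) :+ (:- con (1 , 0) :+ u :* (a :+ u :* con (0 , 0)))) P.refl a u ⟩
      P.1# P.+ (P.- P.1# P.+ u P.* (a P.+ u P.* P.0#))         ≈⟨ P.+-congˡ e ⟩
      P.1# P.+ P.0#                                            ≈⟨ P.+-identityʳ _ ⟩
      P.1#                                                     ∎)
      where
      open SetoidReasoning P.setoid
      open Solver P

    open Series P using (seriesRing; embed; constantTerm; ⊛-vanishes; ⊛-vanishes-next; embed-⊛)
    private
      module U = CommutativeRing seriesRing
      module EU = Evaluation seriesRing

    residue : RingHomomorphism U.rawRing F.rawRing
    residue = compose F constantTerm ε

    agrees : ∀ n (e e′ d q : U.Carrier) → e U.- e′ U.≈ d U.* q → (∀ k → k ≤ n → d k P.≈ P.0#) → e n P.≈ e′ n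
    agrees n e e′ d q e-e′≈dq d≈0 = begin
      e n                    ≈⟨ EP.telescope (e n) (e′ n) ⟩
      e′ n P.+ (e n P.- e′ n)  ≈⟨ P.+-congˡ (e-e′≈dq n) ⟩
      e′ n P.+ (d U.* q) n     ≈⟨ P.+-congˡ (⊛-vanishes d q n d≈0) ⟩
      e′ n P.+ P.0#            ≈⟨ P.+-identityʳ _ ⟩
      e′ n                     ∎
      where open SetoidReasoning P.setoid

    module _ {A : Set c} (φ : A → U.Carrier) (f : List A) (y₀ : F.Carrier)
             (root : EF.eval (λ a → ⟦ φ a 0 ⟧) y₀ f F.≈ F.0#)
             (simple : ¬ (EF.quotient (λ a → ⟦ φ a 0 ⟧) y₀ y₀ f F.≈ F.0#)) where
      private
        φ₀ : A → P.Carrier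
        φ₀ a = φ a 0

        -- The root of f modulo the new variable, supplied by the Henselian property of P itself.
        w : P.Carrier
        w = proj₁ (henselian φ₀ f y₀ root simple)
        w-root : EP.eval φ₀ w f P.≈ P.0#
        w-root = proj₁ (proj₂ (henselian φ₀ f y₀ root simple))
        w-residue : ⟦ w ⟧ F.≈ y₀
        w-residue = proj₂ (proj₂ (henselian φ₀ f y₀ root simple))

        slope-unit : ∃[ u ] EP.quotient φ₀ w w f P.* u P.≈ P.1#
        slope-unit = invertible (EP.quotient φ₀ w w f) λ e → simple (F.trans
          (F.sym (F.trans (quotient-homo ε φ₀ w w f) (EF.quotient-congˡ _ f w-residue w-residue))) e)
        u : P.Carrier
        u = proj₁ slope-unit

      -- Newton's iteration with the slope frozen at `w`. A single inverse in P then suffices, at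
      -- the price of gaining one coefficient per step instead of doubling their number.
      newton : U.Carrier → U.Carrier
      newton y = y U.- embed u U.* EU.eval φ y f

      iterate : ℕ → U.Carrier
      iterate zero    = embed w
      iterate (suc i) = newton (iterate i)

      correction : ∀ y k → (∀ i → i ≤ k → EU.eval φ y f i P.≈ P.0#) → newton y k P.≈ y k
      correction y k E≈0 = begin
        y k P.- (embed u U.* EU.eval φ y f) k  ≈⟨ P.+-congˡ (P.-‿cong (embed-⊛ u (EU.eval φ y f) k)) ⟩
        y k P.- u P.* EU.eval φ y f k          ≈⟨ P.+-congˡ (P.-‿cong (P.*-congˡ (E≈0 k ℕ.≤-refl))) ⟩
        y k P.- u P.* P.0#                     ≈⟨ solve 2 (λ y u → y :- u :* con (0 , 0) := y) P.refl (y k) u ⟩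
        y k                                    ∎
        where
        open SetoidReasoning P.setoid
        open Solver P

      newton-gains : ∀ (e q : U.Carrier) n → (∀ i → i < n → e i P.≈ P.0#) → q 0 P.* u P.≈ P.1# →
                     (e U.* (U.1# U.- embed u U.* q)) n P.≈ P.0#
      newton-gains e q n e≈0 qu≈1 = ⊛-vanishes-next e (U.1# U.- embed u U.* q) n e≈0 (begin
        P.1# P.- u P.* q 0  ≈⟨ P.+-congˡ (P.-‿cong (P.trans (P.*-comm u (q 0)) qu≈1)) ⟩
        P.1# P.- P.1#       ≈⟨ P.-‿inverseʳ _ ⟩
        P.0#                ∎)
        where open SetoidReasoning P.setoid

      -- The constant term of the divided difference depends only on the constant terms of y and y′.
      -- Both are `w`, so it is the derivative at `w`, of which u is the inverse.
      newton-slope : ∀ y y′ → y 0 P.≈ w → y′ 0 P.≈ w → EU.quotient φ y′ y f 0 P.* u P.≈ P.1#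
      newton-slope y y′ y₀≈w y′₀≈w = P.trans
        (P.*-congʳ (P.trans (quotient-homo constantTerm φ y′ y f) (EP.quotient-congˡ φ₀ f y′₀≈w y₀≈w)))
        (proj₂ slope-unit)

      newton-root : ∀ y n → y 0 P.≈ w → (∀ k → k ≤ n → EU.eval φ y f k P.≈ P.0#) →
                    newton y 0 P.≈ w × (∀ k → k ≤ suc n → EU.eval φ (newton y) f k P.≈ P.0#)
      newton-root y n y₀≈w E≈0 = y′₀≈w , λ k k≤1+n → P.trans (EU.eval-newton φ (embed u) y f k)
        (newton-gains (EU.eval φ y f) (EU.quotient φ (newton y) y f) k
          (λ i i<k → E≈0 i (s≤s⁻¹ (ℕ.≤-trans i<k k≤1+n))) (newton-slope y (newton y) y₀≈w y′₀≈w))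
        where
        y′₀≈w : newton y 0 P.≈ w
        y′₀≈w = P.trans (correction y 0 λ { zero z≤n → E≈0 0 z≤n }) y₀≈w

      iterate-root : ∀ n → iterate n 0 P.≈ w × (∀ k → k ≤ n → EU.eval φ (iterate n) f k P.≈ P.0#)
      iterate-root zero    = P.refl , λ { zero z≤n → P.trans (eval-homo constantTerm φ (embed w) f) w-root }
      iterate-root (suc n) = newton-root (iterate n) n (proj₁ (iterate-root n)) (proj₂ (iterate-root n))

      iterate-step : ∀ n k → k ≤ n → iterate (suc n) k P.≈ iterate n k
      iterate-step n k k≤n = correction (iterate n) k λ i i≤k → proj₂ (iterate-root n) i (ℕ.≤-trans i≤k k≤n)

      iterate-stable : ∀ n k → n ≤′ k → iterate n n P.≈ iterate k n
      iterate-stable n k       ≤′-refl        = P.refl {iterate n n}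
      iterate-stable n (suc k) (≤′-step n≤′k) =
        P.trans (iterate-stable n k n≤′k) (P.sym (iterate-step k n (ℕ.≤′⇒≤ n≤′k)))

      -- The diagonal of the iterates: coefficient k no longer changes from step k on.
      limit : U.Carrier
      limit k = iterate k k

      -- Evaluation is continuous for the adic topology, because y - z divides f(y) - f(z).
      eval-agrees : ∀ y z n → (∀ k → k ≤ n → y k P.≈ z k) → EU.eval φ y f n P.≈ EU.eval φ z f n
      eval-agrees y z n y≈z = agrees n (EU.eval φ y f) (EU.eval φ z f) (y U.- z) (EU.quotient φ y z f)
        (EU.eval-difference φ y z f) (λ k k≤n → P.trans (P.+-congʳ (y≈z k k≤n)) (P.-‿inverseʳ _))

      limit-root : EU.eval φ limit f U.≈ U.0#
      limit-root k = P.trans (eval-agrees limit (iterate k) k λ i i≤k → iterate-stable i k (ℕ.≤⇒≤′ i≤k)) (proj₂ (iterate-root k) k ℕ.≤-refl)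

      limit-residue : ⟦ limit 0 ⟧ F.≈ y₀
      -- `limit 0` is the iterate of index 0 at degree 0, which computes to `w`.
      limit-residue = w-residue

    henselian-series : Henselian seriesRing residue
    henselian-series φ f y₀ root simple =
      limit φ f y₀ root simple , limit-root φ f y₀ root simple , limit-residue φ f y₀ root simple

-- Polynomials in one variable

module Polynomials {c ℓ} (R : CommutativeRing c ℓ) where
  open CommutativeRing R
  open RingProperties ring using (-0#≈0#)
  open Series R using (_⊛_; seriesRing; ⊛-zeroˡ)

  Poly : Set c
  Poly = List Carrier

  coeff : Poly → ℕ → Carrier
  coeff []      _       = 0#
  coeff (a ∷ f) zero    = a
  coeff (a ∷ f) (suc k) = coeff f k

  infix 4 _≈ₚ_
  -- A record, so that unification can recover f and g from the type of an equation.
  record _≈ₚ_ (f g : Poly) : Set ℓ where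
    constructor coeffwise
    field coeff-≈ : ∀ k → coeff f k ≈ coeff g k
  open _≈ₚ_ public

  infixl 6 _+ₚ_
  _+ₚ_ : Poly → Poly → Poly
  []      +ₚ g       = g
  (a ∷ f) +ₚ []      = a ∷ f
  (a ∷ f) +ₚ (b ∷ g) = a + b ∷ (f +ₚ g)

  infixl 7 _*ₚ_
  _*ₚ_ : Poly → Poly → Poly
  []      *ₚ g = []
  (a ∷ f) *ₚ g = List.map (a *_) g +ₚ (0# ∷ (f *ₚ g))

  coeff-+ : ∀ f g k → coeff (f +ₚ g) k ≈ coeff f k + coeff g k
  coeff-+ []      g       k       = sym (+-identityˡ _)
  coeff-+ (a ∷ f) []      k       = sym (+-identityʳ _)
  coeff-+ (a ∷ f) (b ∷ g) zero    = refl
  coeff-+ (a ∷ f) (b ∷ g) (suc k) = coeff-+ f g k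

  coeff-scale : ∀ a f k → coeff (List.map (a *_) f) k ≈ a * coeff f k
  coeff-scale a []      k       = sym (zeroʳ a)
  coeff-scale a (b ∷ f) zero    = refl
  coeff-scale a (b ∷ f) (suc k) = coeff-scale a f k

  coeff-neg : ∀ f k → coeff (List.map (λ a → - a) f) k ≈ - coeff f k
  coeff-neg []      k       = sym -0#≈0#
  coeff-neg (b ∷ f) zero    = refl
  coeff-neg (b ∷ f) (suc k) = coeff-neg f k

  coeff-* : ∀ f g k → coeff (f *ₚ g) k ≈ (coeff f ⊛ coeff g) k
  coeff-* []      g k       = sym (⊛-zeroˡ (coeff g) k)
  coeff-* (a ∷ f) g zero    = trans (coeff-+ (List.map (a *_) g) _ 0) (trans (+-identityʳ _) (coeff-scale a g 0))
  coeff-* (a ∷ f) g (suc k) = trans (coeff-+ (List.map (a *_) g) _ (suc k)) (+-cong (coeff-scale a g (suc k)) (coeff-* f g k))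

  constantₚ : Carrier → Poly
  constantₚ a = a ∷ []

  polyRawRing : RawRing c ℓ
  polyRawRing = record
    { Carrier = Poly
    ; _≈_     = _≈ₚ_
    ; _+_     = _+ₚ_
    ; _*_     = _*ₚ_
    ; -_      = List.map (λ a → - a)
    ; 0#      = []
    ; 1#      = constantₚ 1#
    }

  -- Polynomials sit inside the power series, and all their ring laws are pulled back from there.
  coeff-isRingMonomorphism : IsRingMonomorphism polyRawRing (CommutativeRing.rawRing seriesRing) coeff
  coeff-isRingMonomorphism = record
    { isRingHomomorphism = record
      { isSemiringHomomorphism = record
        { isNearSemiringHomomorphism = record
          { +-isMonoidHomomorphism = record
            { isMagmaHomomorphism = record
              { isRelHomomorphism = record { cong = coeff-≈ } ; homo = coeff-+ }
            ; ε-homo = λ _ → refl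
            }
          ; *-homo = coeff-*
          }
        ; 1#-homo = λ { zero → refl ; (suc _) → refl }
        }
      ; -‿homo = coeff-neg
      }
    ; injective = coeffwise
    }

  polyRing : CommutativeRing c ℓ
  polyRing = record
    { isCommutativeRing =
        RingMonomorphism.isCommutativeRing coeff-isRingMonomorphism (CommutativeRing.isCommutativeRing seriesRing)
    }

  constantHom : RingHomomorphism rawRing polyRawRing
  constantHom = ringHomomorphism R polyRing constantₚ
    (λ e → coeffwise λ { zero → e ; (suc _) → refl })
    (λ _ _ → coeffwise λ _ → refl)
    (λ _ _ → coeffwise λ { zero → sym (+-identityʳ _) ; (suc zero) → refl ; (suc (suc _)) → refl })
    (coeffwise λ _ → refl)

  X : Poly
  X = 0# ∷ 1# ∷ []

  ∷-≈ : ∀ a f → a ∷ f ≈ₚ constantₚ a +ₚ X *ₚ f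
  ∷-≈ a f = coeffwise λ k → sym (trans (coeff-+ (constantₚ a) (X *ₚ f) k) (lemma k))
    where
    open SetoidReasoning setoid
    open Series R using (⊛-identityˡ)
    lemma : ∀ k → coeff (constantₚ a) k + coeff (X *ₚ f) k ≈ coeff (a ∷ f) k
    lemma zero    = trans (+-congˡ (trans (coeff-* X f 0) (zeroˡ _))) (+-identityʳ a)
    lemma (suc k) = begin
      0# + coeff (X *ₚ f) (suc k)                          ≈⟨ +-identityˡ _ ⟩
      coeff (X *ₚ f) (suc k)                               ≈⟨ coeff-* X f (suc k) ⟩
      0# * coeff f (suc k) + (coeff (1# ∷ []) ⊛ coeff f) k ≈⟨ +-cong (zeroˡ _) (⊛-cong′ k) ⟩
      0# + coeff f k                                       ≈⟨ +-identityˡ _ ⟩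
      coeff f k                                            ∎
      where
      ⊛-cong′ : ∀ k → (coeff (1# ∷ []) ⊛ coeff f) k ≈ coeff f k
      ⊛-cong′ k = trans (Series.⊛-cong R (λ { zero → refl ; (suc _) → refl }) (λ _ → refl) k) (⊛-identityˡ (coeff f) k)

  -- Degree less than d. Lists may end in zeros, so their length is only an upper bound, and the
  -- zero polynomial is below every d, including 0.
  Below : ℕ → Poly → Set ℓ
  Below d f = ∀ k → d ≤ k → coeff f k ≈ 0#

  Below-≤ : ∀ {d e} f → d ≤ e → Below d f → Below e f
  Below-≤ f d≤e p k e≤k = p k (ℕ.≤-trans d≤e e≤k)

  Below-length : ∀ f → Below (List.length f) f
  Below-length []      k       _       = refl
  Below-length (a ∷ f) (suc k) (s≤s p) = Below-length f k p

  Below-zero : ∀ {f} → Below 0 f → f ≈ₚ []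
  Below-zero p = coeffwise λ k → p k z≤n

  Below-one : ∀ {f} → Below 1 f → f ≈ₚ constantₚ (coeff f 0)
  Below-one p = coeffwise λ { zero → refl ; (suc k) → p (suc k) (s≤s z≤n) }

  ⊛-top : ∀ (f g : ℕ → Carrier) p q → (∀ k → p < k → f k ≈ 0#) → (∀ k → q < k → g k ≈ 0#) →
          (f ⊛ g) (p ℕ.+ q) ≈ f p * g q
  ⊛-top f g zero    zero    f≈0 g≈0 = refl
  ⊛-top f g zero    (suc q) f≈0 g≈0 = trans (+-congˡ (trans
    (Series.⊛-cong R (λ k → f≈0 (suc k) (s≤s z≤n)) (λ _ → refl) q) (⊛-zeroˡ g q))) (+-identityʳ _)
  ⊛-top f g (suc p) q       f≈0 g≈0 = trans (+-cong
    (trans (*-congˡ (g≈0 (suc (p ℕ.+ q)) (s≤s (ℕ.m≤n+m q p)))) (zeroʳ _))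
    (⊛-top (f ∘ suc) g p q (λ k p<k → f≈0 (suc k) (s≤s p<k)) g≈0)) (+-identityˡ _)

  coeff-*-top : ∀ f g p q → Below (suc p) f → Below (suc q) g → coeff (f *ₚ g) (p ℕ.+ q) ≈ coeff f p * coeff g q
  coeff-*-top f g p q f<p g<q = trans (coeff-* f g (p ℕ.+ q)) (⊛-top (coeff f) (coeff g) p q f<p g<q)

  -- The product rule for a + x f.
  derivative : Poly → Poly
  derivative []      = []
  derivative (a ∷ f) = f +ₚ (0# ∷ derivative f)

  open RawSemiringDefs (RawRing.rawSemiring rawRing) using () renaming (_×_ to _·_)

  coeff-derivative : ∀ f k → coeff (derivative f) k ≈ suc k · coeff f (suc k)
  coeff-derivative []      k       = sym (lemma (suc k))
    where
    lemma : ∀ n → n · 0# ≈ 0#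
    lemma zero    = refl
    lemma (suc n) = trans (+-identityˡ _) (lemma n)
  coeff-derivative (a ∷ f) zero    = coeff-+ f (0# ∷ derivative f) 0
  coeff-derivative (a ∷ f) (suc k) = trans (coeff-+ f (0# ∷ derivative f) (suc k)) (+-congˡ (coeff-derivative f k))

  module _ {c′ ℓ′} {T : CommutativeRing c′ ℓ′} (φ : RingHomomorphism rawRing (CommutativeRing.rawRing T)) where
    private
      module T = CommutativeRing T
    open Evaluation T hiding (telescope)
    open RingHomomorphism φ
    open SetoidReasoning T.setoid
    open CommutativeSemigroupProperties T.+-commutativeSemigroup using (interchange)

    module _ (y : T.Carrier) where
      private
        ev : Poly → T.Carrier
        ev = eval ⟦_⟧ y

      eval-zero : ∀ f → f ≈ₚ [] → ev f T.≈ T.0#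
      eval-zero []      e = T.refl
      eval-zero (a ∷ f) e = begin
        ⟦ a ⟧ T.+ y T.* ev f  ≈⟨ T.+-cong (T.trans (⟦⟧-cong (coeff-≈ e 0)) 0#-homo) (T.*-congˡ (eval-zero f (coeffwise (coeff-≈ e ∘ suc)))) ⟩
        T.0# T.+ y T.* T.0#   ≈⟨ T.trans (T.+-identityˡ _) (T.zeroʳ y) ⟩
        T.0#                  ∎

      eval-cong : ∀ f g → f ≈ₚ g → ev f T.≈ ev g
      eval-cong []      g       e = T.sym (eval-zero g (coeffwise λ k → sym (coeff-≈ e k)))
      eval-cong (a ∷ f) []      e = eval-zero (a ∷ f) e
      eval-cong (a ∷ f) (b ∷ g) e = T.+-cong (⟦⟧-cong (coeff-≈ e 0)) (T.*-congˡ (eval-cong f g (coeffwise (coeff-≈ e ∘ suc))))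

      eval-+ : ∀ f g → ev (f +ₚ g) T.≈ ev f T.+ ev g
      eval-+ []      g       = T.sym (T.+-identityˡ _)
      eval-+ (a ∷ f) []      = T.sym (T.+-identityʳ _)
      eval-+ (a ∷ f) (b ∷ g) = begin
        ⟦ a + b ⟧ T.+ y T.* ev (f +ₚ g)                        ≈⟨ T.+-cong (+-homo a b) (T.*-congˡ (eval-+ f g)) ⟩
        (⟦ a ⟧ T.+ ⟦ b ⟧) T.+ y T.* (ev f T.+ ev g)            ≈⟨ T.+-congˡ (T.distribˡ _ _ _) ⟩
        (⟦ a ⟧ T.+ ⟦ b ⟧) T.+ (y T.* ev f T.+ y T.* ev g)      ≈⟨ interchange _ _ _ _ ⟩
        ev (a ∷ f) T.+ ev (b ∷ g)                              ∎

      eval-shift : ∀ f → ev (0# ∷ f) T.≈ y T.* ev f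
      eval-shift f = T.trans (T.+-congʳ 0#-homo) (T.+-identityˡ _)

      eval-constant : ∀ a → ev (constantₚ a) T.≈ ⟦ a ⟧
      eval-constant a = T.trans (T.+-congˡ (T.zeroʳ y)) (T.+-identityʳ _)

      eval-X : ev X T.≈ y
      eval-X = T.trans (eval-shift (1# ∷ [])) (T.trans (T.*-congˡ (T.trans (eval-constant 1#) 1#-homo)) (T.*-identityʳ y))

      eval-scale : ∀ a f → ev (List.map (a *_) f) T.≈ ⟦ a ⟧ T.* ev f
      eval-scale a []      = T.sym (T.zeroʳ _)
      eval-scale a (b ∷ f) = begin
        ⟦ a * b ⟧ T.+ y T.* ev (List.map (a *_) f)       ≈⟨ T.+-cong (*-homo a b) (T.*-congˡ (eval-scale a f)) ⟩
        ⟦ a ⟧ T.* ⟦ b ⟧ T.+ y T.* (⟦ a ⟧ T.* ev f)       ≈⟨ solve 4 (λ a b y p → a :* b :+ y :* (a :* p) := a :* (b :+ y :* p)) T.refl ⟦ a ⟧ ⟦ b ⟧ y (ev f) ⟩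
        ⟦ a ⟧ T.* ev (b ∷ f)                             ∎
        where open Solver T

      eval-* : ∀ f g → ev (f *ₚ g) T.≈ ev f T.* ev g
      eval-* []      g = T.sym (T.zeroˡ _)
      eval-* (a ∷ f) g = begin
        ev (List.map (a *_) g +ₚ (0# ∷ (f *ₚ g)))             ≈⟨ eval-+ (List.map (a *_) g) (0# ∷ (f *ₚ g)) ⟩
        ev (List.map (a *_) g) T.+ ev (0# ∷ (f *ₚ g))         ≈⟨ T.+-cong (eval-scale a g) (T.trans (eval-shift (f *ₚ g)) (T.*-congˡ (eval-* f g))) ⟩
        ⟦ a ⟧ T.* ev g T.+ y T.* (ev f T.* ev g)              ≈⟨ T.+-congˡ (T.*-assoc _ _ _) ⟨
        ⟦ a ⟧ T.* ev g T.+ y T.* ev f T.* ev g                ≈⟨ T.distribʳ _ _ _ ⟨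
        ev (a ∷ f) T.* ev g                                   ∎

      evaluation : RingHomomorphism polyRawRing T.rawRing
      evaluation = ringHomomorphism polyRing T ev (λ {f} {g} → eval-cong f g) eval-+ eval-* (T.trans (eval-constant 1#) 1#-homo)

      -- Connects the formal derivative, whose coefficients and degree are known, with the divided
      -- difference in which Hensel's lemma expresses simplicity.
      eval-derivative : ∀ f → ev (derivative f) T.≈ quotient ⟦_⟧ y y f
      eval-derivative []      = T.refl
      eval-derivative (a ∷ f) = T.trans (eval-+ f (0# ∷ derivative f))
        (T.+-congˡ (T.trans (eval-shift (derivative f)) (T.*-congˡ (eval-derivative f))))

-- Ideals, quotient rings and domains

record Ideal {c ℓ} (R : CommutativeRing c ℓ) ℓ′ : Set (c ⊔ ℓ ⊔ lsuc ℓ′) where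
  open CommutativeRing R
  field
    I   : Carrier → Set ℓ′
    I-≈ : ∀ {x y} → x ≈ y → I x → I y
    I-0 : I 0#
    I-+ : ∀ {x y} → I x → I y → I (x + y)
    I-* : ∀ x {y} → I y → I (x * y)

module QuotientRing {c ℓ ℓ′} (R : CommutativeRing c ℓ) (ideal : Ideal R ℓ′) where

  open CommutativeRing R
  open Ideal ideal
  open Solver R

  infix 4 _≈ᵢ_
  record _≈ᵢ_ (x y : Carrier) : Set ℓ′ where
    constructor mod
    field difference : I (x - y)
  open _≈ᵢ_ public

  ≈⇒≈ᵢ : ∀ {x y} → x ≈ y → x ≈ᵢ y
  ≈⇒≈ᵢ {x} {y} x≈y = mod (I-≈ (trans (sym (-‿inverseʳ y)) (+-congʳ (sym x≈y))) I-0)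

  quotientRing : CommutativeRing c ℓ′
  quotientRing = record
    { Carrier = Carrier
    ; _≈_ = _≈ᵢ_
    ; _+_ = _+_
    ; _*_ = _*_
    ; -_  = λ x → - x
    ; 0#  = 0#
    ; 1#  = 1#
    ; isCommutativeRing = record
      { isRing = record
        { +-isAbelianGroup = record
          { isGroup = record
            { isMonoid = record
              { isSemigroup = record
                { isMagma = record
                  { isEquivalence = record
                    { refl  = ≈⇒≈ᵢ refl
                    ; sym   = λ {x} {y} (mod p) → mod (I-≈ (solve 2 (λ x y → :- con (1 , 0) :* (x :- y) := y :- x) refl x y) (I-* (- 1#) p))
                    ; trans = λ {x} {y} {z} (mod p) (mod q) → mod (I-≈ (solve 3 (λ x y z → (x :- y) :+ (y :- z) := x :- z) refl x y z) (I-+ p q))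
                    }
                  ; ∙-cong = λ {x} {y} {u} {v} (mod p) (mod q) →
                      mod (I-≈ (solve 4 (λ x y u v → (x :- y) :+ (u :- v) := (x :+ u) :- (y :+ v)) refl x y u v) (I-+ p q))
                  }
                ; assoc = λ x y z → ≈⇒≈ᵢ (+-assoc x y z)
                }
              ; identity = (λ x → ≈⇒≈ᵢ (+-identityˡ x)) , λ x → ≈⇒≈ᵢ (+-identityʳ x)
              }
            ; inverse = (λ x → ≈⇒≈ᵢ (-‿inverseˡ x)) , λ x → ≈⇒≈ᵢ (-‿inverseʳ x)
            ; ⁻¹-cong = λ {x} {y} (mod p) → mod (I-≈ (solve 2 (λ x y → :- con (1 , 0) :* (x :- y) := (:- x) :- (:- y)) refl x y) (I-* (- 1#) p))
            }
          ; comm = λ x y → ≈⇒≈ᵢ (+-comm x y)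
          }
        ; *-cong = λ {x} {y} {u} {v} (mod p) (mod q) →
            mod (I-≈ (solve 4 (λ x y u v → u :* (x :- y) :+ y :* (u :- v) := (x :* u) :- (y :* v)) refl x y u v) (I-+ (I-* u p) (I-* y q)))
        ; *-assoc = λ x y z → ≈⇒≈ᵢ (*-assoc x y z)
        ; *-identity = (λ x → ≈⇒≈ᵢ (*-identityˡ x)) , λ x → ≈⇒≈ᵢ (*-identityʳ x)
        ; distrib = (λ x y z → ≈⇒≈ᵢ (distribˡ x y z)) , λ x y z → ≈⇒≈ᵢ (distribʳ x y z)
        }
      ; *-comm = λ x y → ≈⇒≈ᵢ (*-comm x y)
      }
    }

  I⇒≈0 : ∀ {x} → I x → x ≈ᵢ 0#
  I⇒≈0 {x} p = mod (I-≈ (solve 1 (λ x → x := x :- con (0 , 0)) refl x) p)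

  ≈0⇒I : ∀ {x} → x ≈ᵢ 0# → I x
  ≈0⇒I {x} (mod p) = I-≈ (solve 1 (λ x → x :- con (0 , 0) := x) refl x) p

  module _ {c′ ℓ″} {T : CommutativeRing c′ ℓ″} (φ : RingHomomorphism rawRing (CommutativeRing.rawRing T)) where
    private
      module T = CommutativeRing T
      module φ = RingHomomorphism φ
    open RingProperties T.ring using (x∙y⁻¹≈ε⇒x≈y)

    factor : (∀ {x} → I x → φ.⟦ x ⟧ T.≈ T.0#) → RingHomomorphism (CommutativeRing.rawRing quotientRing) T.rawRing
    factor vanishes = ringHomomorphism quotientRing T φ.⟦_⟧
      (λ {x} {y} (mod p) → x∙y⁻¹≈ε⇒x≈y _ _ (T.trans (T.sym (T.trans (φ.+-homo x (- y)) (T.+-congˡ (φ.-‿homo y)))) (vanishes p)))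
      φ.+-homo φ.*-homo φ.1#-homo

record IsDomain {c ℓ} (R : CommutativeRing c ℓ) : Set (c ⊔ ℓ) where
  open CommutativeRing R
  field
    1≉0          : ¬ (1# ≈ 0#)
    zero-product : ∀ x y → x * y ≈ 0# → x ≈ 0# ⊎ y ≈ 0#

  open RawSemiringDefs (RawRing.rawSemiring rawRing) using (_^_)

  *-≉0 : ∀ {x y} → ¬ (x ≈ 0#) → ¬ (y ≈ 0#) → ¬ (x * y ≈ 0#)
  *-≉0 {x} {y} x≉0 y≉0 xy≈0 with zero-product x y xy≈0
  ... | inj₁ x≈0 = x≉0 x≈0
  ... | inj₂ y≈0 = y≉0 y≈0

  ^-≉0 : ∀ {x} → ¬ (x ≈ 0#) → ∀ n → ¬ (x ^ n ≈ 0#)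
  ^-≉0 x≉0 zero    = 1≉0
  ^-≉0 x≉0 (suc n) = *-≉0 x≉0 (^-≉0 x≉0 n)

-- Pseudo-division

-- The identities are proved for elements of an arbitrary commutative ring, so that the solver meets
-- variables and not polynomial expressions.
module PseudoDivisionIdentities {c ℓ} (T : CommutativeRing c ℓ) where
  open CommutativeRing T
  open Solver T
  open SetoidReasoning setoid

  -- The tail k′ of k = a + x k′ has been divided: c k′ = q h + r. Multiplying by l c leaves l s
  -- with s = c a + x r, and subtracting t h is meant to cancel its top term.
  division-step : ∀ lc l c k a x k′ q h r t s ca → lc ≈ l * c → k ≈ a + x * k′ → c * k′ ≈ q * h + r →
                  s ≈ ca + x * r → ca ≈ c * a → lc * k ≈ (l * (x * q) + t) * h + (l * s - t * h)
  division-step lc l c k a x k′ q h r t s ca lc≈ k≈ ck′≈ s≈ ca≈ = begin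
    lc * k                                               ≈⟨ *-cong lc≈ k≈ ⟩
    (l * c) * (a + x * k′)                               ≈⟨ solve 5 (λ l c a x k′ → (l :* c) :* (a :+ x :* k′) := l :* (c :* a) :+ (l :* x) :* (c :* k′)) refl l c a x k′ ⟩
    l * (c * a) + (l * x) * (c * k′)                     ≈⟨ +-congˡ (*-congˡ ck′≈) ⟩
    l * (c * a) + (l * x) * (q * h + r)                  ≈⟨ solve 8 (λ l c a x q h r t → l :* (c :* a) :+ (l :* x) :* (q :* h :+ r) := (l :* (x :* q) :+ t) :* h :+ (l :* (c :* a :+ x :* r) :- t :* h)) refl l c a x q h r t ⟩
    (l * (x * q) + t) * h + (l * (c * a + x * r) - t * h) ≈⟨ +-congˡ (+-congʳ (*-congˡ (trans s≈ (+-congʳ ca≈)))) ⟨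
    (l * (x * q) + t) * h + (l * s - t * h)              ∎

  euclid-step : ∀ u v c q m h r ρ → c * h ≈ q * m + r → u * r + v * h ≈ ρ → (- (u * q)) * m + (u * c + v) * h ≈ ρ
  euclid-step u v c q m h r ρ ch≈ ρ≈ = begin
    (- (u * q)) * m + (u * c + v) * h                  ≈⟨ solve 6 (λ u v c q m h → (:- (u :* q)) :* m :+ (u :* c :+ v) :* h := u :* (c :* h :- q :* m) :+ v :* h) refl u v c q m h ⟩
    u * (c * h - q * m) + v * h                        ≈⟨ +-congʳ (*-congˡ (+-congʳ ch≈)) ⟩
    u * (q * m + r - q * m) + v * h                    ≈⟨ solve 6 (λ u q m r v h → u :* (q :* m :+ r :- q :* m) :+ v :* h := u :* r :+ v :* h) refl u q m r v h ⟩
    u * r + v * h                                      ≈⟨ ρ≈ ⟩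
    ρ                                                  ∎

  bezout-lift : ∀ u v c q k h r ρ → c * k ≈ q * h + r → u * r + v * h ≈ ρ → (u * c) * k + (v - u * q) * h ≈ ρ
  bezout-lift u v c q k h r ρ ck≈ ρ≈ = begin
    (u * c) * k + (v - u * q) * h              ≈⟨ solve 6 (λ u v c q k h → (u :* c) :* k :+ (v :- u :* q) :* h := u :* (c :* k :- q :* h) :+ v :* h) refl u v c q k h ⟩
    u * (c * k - q * h) + v * h                ≈⟨ +-congʳ (*-congˡ (+-congʳ ck≈)) ⟩
    u * (q * h + r - q * h) + v * h            ≈⟨ solve 5 (λ u q h r v → u :* (q :* h :+ r :- q :* h) :+ v :* h := u :* r :+ v :* h) refl u q h r v ⟩
    u * r + v * h                              ≈⟨ ρ≈ ⟩
    ρ                                          ∎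

  ideal-+ : ∀ c x p h d y q → c * x ≈ p * h → d * y ≈ q * h → (c * d) * (x + y) ≈ (d * p + c * q) * h
  ideal-+ c x p h d y q cx≈ dy≈ = begin
    (c * d) * (x + y)                  ≈⟨ solve 4 (λ c x d y → (c :* d) :* (x :+ y) := d :* (c :* x) :+ c :* (d :* y)) refl c x d y ⟩
    d * (c * x) + c * (d * y)          ≈⟨ +-cong (*-congˡ cx≈) (*-congˡ dy≈) ⟩
    d * (p * h) + c * (q * h)          ≈⟨ solve 5 (λ c p h d q → d :* (p :* h) :+ c :* (q :* h) := (d :* p :+ c :* q) :* h) refl c p h d q ⟩
    (d * p + c * q) * h                ∎

  ideal-* : ∀ c y q h x → c * y ≈ q * h → c * (x * y) ≈ (x * q) * h
  ideal-* c y q h x cy≈ = begin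
    c * (x * y)  ≈⟨ solve 3 (λ c x y → c :* (x :* y) := x :* (c :* y)) refl c x y ⟩
    x * (c * y)  ≈⟨ *-congˡ cy≈ ⟩
    x * (q * h)  ≈⟨ *-assoc x q h ⟨
    (x * q) * h  ∎

module PseudoDivision {c ℓ} (R : CommutativeRing c ℓ) where
  open CommutativeRing R
  open Polynomials R
  open RawSemiringDefs (RawRing.rawSemiring rawRing) using (_^_)
  private
    module P = CommutativeRing polyRing

  coeff-constant-* : ∀ a f k → coeff (constantₚ a *ₚ f) k ≈ a * coeff f k
  coeff-constant-* a f k = trans (coeff-* (constantₚ a) f k)
    (trans (Series.⊛-cong R (λ { zero → refl ; (suc _) → refl }) (λ _ → refl) k) (Series.embed-⊛ R a (coeff f) k))

  module _ (d : ℕ) (h : Poly) (h-below : Below (suc d) h) where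
    private
      l : Carrier
      l = coeff h d

    reduce : Poly → Poly
    reduce s = constantₚ l *ₚ s P.- constantₚ (coeff s d) *ₚ h

    reduce-below : ∀ s → Below (suc d) s → Below d (reduce s)
    reduce-below s s-below k d≤k = begin
      coeff (reduce s) k
        ≈⟨ coeff-+ (constantₚ l *ₚ s) _ k ⟩
      coeff (constantₚ l *ₚ s) k + coeff (P.- (constantₚ t *ₚ h)) k
        ≈⟨ +-cong (coeff-constant-* l s k) (trans (coeff-neg (constantₚ t *ₚ h) k) (-‿cong (coeff-constant-* t h k))) ⟩
      l * coeff s k - t * coeff h k
        ≈⟨ cancels (ℕ.m≤n⇒m<n∨m≡n d≤k) ⟩
      0# ∎
      where
      open SetoidReasoning setoid
      t : Carrier
      t = coeff s d
      cancels : d < k ⊎ d ≡ k → l * coeff s k - t * coeff h k ≈ 0#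
      cancels (inj₁ d<k)    = trans (+-cong (trans (*-congˡ (s-below k d<k)) (zeroʳ l)) (-‿cong (trans (*-congˡ (h-below k d<k)) (zeroʳ t)))) (-‿inverseʳ 0#)
      cancels (inj₂ ≡.refl) = trans (+-congʳ (*-comm l t)) (-‿inverseʳ (t * l))

    -- Recursion on the coefficient list. The remainder of the tail has degree less than d;
    -- multiplication by X raises this bound by one, and one `reduce` restores it at the cost of a
    -- factor l.
    pseudo-division : ∀ k → ∃[ e ] ∃[ q ] ∃[ r ] Below d r × constantₚ (l ^ e) *ₚ k ≈ₚ q *ₚ h +ₚ r
    pseudo-division []      = 0 , [] , [] , (λ _ _ → refl) , P.zeroʳ (constantₚ 1#)
    pseudo-division (a ∷ k) with pseudo-division k
    ... | e , q , r , r-below , eq =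
      suc e , constantₚ l *ₚ (X *ₚ q) +ₚ constantₚ (coeff s d) , reduce s , reduce-below s s-below ,
      PseudoDivisionIdentities.division-step polyRing (constantₚ (l ^ suc e)) (constantₚ l) (constantₚ (l ^ e))
        (a ∷ k) (constantₚ a) X k q h r (constantₚ (coeff s d)) s (constantₚ (l ^ e * a))
        (constantHom.*-homo l (l ^ e)) (∷-≈ a k) eq (∷-≈ (l ^ e * a) r) (constantHom.*-homo (l ^ e) a)
      where
      module constantHom = RingHomomorphism constantHom
      s : Poly
      s = l ^ e * a ∷ r
      s-below : Below (suc d) s
      s-below (suc k) (s≤s d≤k) = r-below k d≤k

module DomainPolynomials {c ℓ} (R : CommutativeRing c ℓ) (isDomain : IsDomain R)
                         (_≟_ : Decidable (CommutativeRing._≈_ R)) where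
  open CommutativeRing R
  open IsDomain isDomain
  open Polynomials R
  open PseudoDivision R
  open RawSemiringDefs (RawRing.rawSemiring rawRing) using (_^_)
  private
    module P = CommutativeRing polyRing

  Leading : ℕ → Poly → Set ℓ
  Leading p f = Below (suc p) f × ¬ (coeff f p ≈ 0#)

  Below-pred : ∀ {n f} → Below (suc n) f → coeff f n ≈ 0# → Below n f
  Below-pred {n} {f} f<1+n fₙ≈0 k n≤k = go (ℕ.m≤n⇒m<n∨m≡n n≤k)
    where
    go : n < k ⊎ n ≡ k → coeff f k ≈ 0#
    go (inj₁ n<k)    = f<1+n k n<k
    go (inj₂ ≡.refl) = fₙ≈0

  leading-below : ∀ n f → Below n f → f ≈ₚ [] ⊎ ∃[ p ] p < n × Leading p f
  leading-below zero    f f<0   = inj₁ (Below-zero f<0)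
  leading-below (suc n) f f<1+n with coeff f n ≟ 0#
  ... | no  fₙ≉0 = inj₂ (n , ℕ.≤-refl , f<1+n , fₙ≉0)
  ... | yes fₙ≈0 with leading-below n f (Below-pred {n} {f} f<1+n fₙ≈0)
  ... | inj₁ f≈0               = inj₁ f≈0
  ... | inj₂ (p , p<n , lead) = inj₂ (p , ℕ.m<n⇒m<1+n p<n , lead)

  leading : ∀ f → f ≈ₚ [] ⊎ ∃[ p ] Leading p f
  leading f with leading-below (List.length f) f (Below-length f)
  ... | inj₁ f≈0            = inj₁ f≈0
  ... | inj₂ (p , _ , lead) = inj₂ (p , lead)

  Leading⇒≉0 : ∀ {p f} → Leading p f → ¬ (f ≈ₚ [])
  Leading⇒≉0 {p} (_ , fₚ≉0) f≈0 = fₚ≉0 (coeff-≈ f≈0 p)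

  Leading-* : ∀ {p q f g} → Leading p f → Leading q g → ¬ (coeff (f *ₚ g) (p ℕ.+ q) ≈ 0#)
  Leading-* {p} {q} {f} {g} (f<p , fₚ≉0) (g<q , g≉0) e =
    *-≉0 fₚ≉0 g≉0 (trans (sym (coeff-*-top f g p q f<p g<q)) e)

  Below-constant-* : ∀ {d} a {f} → Below d f → Below d (constantₚ a *ₚ f)
  Below-constant-* a {f} f<d k d≤k = trans (coeff-constant-* a f k) (trans (*-congˡ (f<d k d≤k)) (zeroʳ a))

  constant-*-≈0 : ∀ {a f} → ¬ (a ≈ 0#) → constantₚ a *ₚ f ≈ₚ [] → f ≈ₚ []
  constant-*-≈0 {a} {f} a≉0 af≈0 = coeffwise λ k → pick k (zero-product a (coeff f k) (trans (sym (coeff-constant-* a f k)) (coeff-≈ af≈0 k)))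
    where
    pick : ∀ k → a ≈ 0# ⊎ coeff f k ≈ 0# → coeff f k ≈ 0#
    pick k (inj₁ a≈0)  = ⊥-elim (a≉0 a≈0)
    pick k (inj₂ fₖ≈0) = fₖ≈0

  polyIsDomain : IsDomain polyRing
  polyIsDomain = record
    { 1≉0 = λ e → 1≉0 (coeff-≈ e 0)
    ; zero-product = λ f g fg≈0 → pick f g fg≈0 (leading f) (leading g)
    }
    where
    pick : ∀ f g → f *ₚ g ≈ₚ [] → f ≈ₚ [] ⊎ (∃[ p ] Leading p f) → g ≈ₚ [] ⊎ (∃[ q ] Leading q g) → f ≈ₚ [] ⊎ g ≈ₚ []
    pick f g fg≈0 (inj₁ f≈0)     _               = inj₁ f≈0
    pick f g fg≈0 (inj₂ _)       (inj₁ g≈0)      = inj₂ g≈0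
    pick f g fg≈0 (inj₂ (p , F)) (inj₂ (q , G))  = ⊥-elim (Leading-* {p} {q} {f} {g} F G (coeff-≈ fg≈0 (p ℕ.+ q)))

  -- The cofactor q is nonzero because c h is; the leading coefficients of q and m then multiply to
  -- a nonzero coefficient, which must lie within the degree of h.
  multiple-degree : ∀ {d p h q m} c → Leading d h → ¬ (c ≈ 0#) → Leading p m → constantₚ c *ₚ h ≈ₚ q *ₚ m →
                    ∃[ s ] Leading s q × s ℕ.+ p ≤ d
  multiple-degree {d} {p} {h} {q} {m} c (h<d , h_d≉0) c≉0 lead-m eq with leading q
  ... | inj₁ q≈0 = ⊥-elim (h_d≉0 (coeff-≈ (constant-*-≈0 {c} {h} c≉0 (P.trans eq (P.trans (P.*-congʳ q≈0) (P.zeroˡ m)))) d))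
  ... | inj₂ (s , lead-q) = s , lead-q , ℕ.≮⇒≥ λ d<s+p →
    Leading-* {s} {p} {q} {m} lead-q lead-m (trans (sym (coeff-≈ eq (s ℕ.+ p)))
      (Below-constant-* c {h} h<d (s ℕ.+ p) d<s+p))

  module _ {d : ℕ} {h : Poly} (h-leading : Leading d h)
           (irreducible : ∀ a b c → ¬ (a ≈ₚ []) → ¬ (b ≈ₚ []) → Below d a → Below d b → ¬ (c ≈ 0#) →
                          ¬ (constantₚ c *ₚ h ≈ₚ a *ₚ b)) where

    Bezout : Poly → Set (c ⊔ ℓ)
    Bezout m = ∃[ u ] ∃[ v ] ∃[ ρ ] ¬ (ρ ≈ 0#) × u *ₚ m +ₚ v *ₚ h ≈ₚ constantₚ ρ

    -- Euclid's algorithm with h kept as the dividend throughout: h is divided by m, and the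
    -- remainder takes the place of m. A zero remainder would exhibit a multiple of h as a product
    -- of factors of smaller degree, so the descent, bounded by n, ends at a nonzero constant.
    bezout-below : ∀ n m → n ≤ d → Below n m → ¬ (m ≈ₚ []) → Bezout m
    bezout-below n m n≤d m<n m≉0 with leading-below n m m<n
    ... | inj₁ m≈0 = ⊥-elim (m≉0 m≈0)
    bezout-below n m n≤d m<n m≉0 | inj₂ (zero , _ , m<1 , m₀≉0) =
      P.1# , P.0# , coeff m 0 , m₀≉0 , P.trans (P.+-cong (P.*-identityˡ m) (P.zeroˡ h)) (P.trans (P.+-identityʳ m) (Below-one m<1))
    bezout-below (suc n) m n<d m<n m≉0 | inj₂ (suc p , s≤s p<n , lead@(m<p , mₚ≉0)) with pseudo-division (suc p) m m<p h
    ... | e , q , r , r<p , eq with leading r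
    ... | inj₁ r≈0 with multiple-degree {d} {suc p} {h} {q} {m} (coeff m (suc p) ^ e) h-leading (^-≉0 mₚ≉0 e) lead
                          (P.trans eq (P.trans (P.+-congˡ r≈0) (P.+-identityʳ (q *ₚ m))))
    -- Since m has degree at least 1, s + suc p ≤ d puts the degree of q strictly below d; m is
    -- below d by n ≤ d. Both factors are therefore proper.
    ...   | s , lead-q@(q<s , _) , s+p≤d = ⊥-elim (irreducible q m (coeff m (suc p) ^ e)
              (Leading⇒≉0 {s} {q} lead-q) m≉0 (Below-≤ q (ℕ.≤-trans (ℕ.≤-trans (s≤s (ℕ.m≤m+n s p)) (ℕ.≤-reflexive (≡.sym (ℕ.+-suc s p)))) s+p≤d) q<s)
              (Below-≤ m n<d m<n) (^-≉0 mₚ≉0 e)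
              (P.trans eq (P.trans (P.+-congˡ r≈0) (P.+-identityʳ (q *ₚ m)))))
    bezout-below (suc n) m n<d m<n m≉0 | inj₂ (suc p , s≤s p<n , lead@(m<p , mₚ≉0)) | e , q , r , r<p , eq | inj₂ (s , lead-r)
      with bezout-below n r (ℕ.<⇒≤ n<d) (Below-≤ r p<n r<p) (Leading⇒≉0 {s} {r} lead-r)
    ... | u , v , ρ , ρ≉0 , eq′ = P.- (u *ₚ q) , u *ₚ constantₚ (coeff m (suc p) ^ e) +ₚ v , ρ , ρ≉0 ,
      PseudoDivisionIdentities.euclid-step polyRing u v (constantₚ (coeff m (suc p) ^ e)) q m h r (constantₚ ρ) eq eq′

-- Substitution along homomorphisms, and roots over an algebraically closed field

module _ {c ℓ₁ ℓ₂} (F : HeytingField c ℓ₁ ℓ₂) where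
  private
    module F = HeytingField F

  fieldRing : CommutativeRing c ℓ₁
  fieldRing = HeytingCommutativeRing.commutativeRing F.heytingCommutativeRing

  module _ {a ℓ b ℓ′} {A : RawRing a ℓ} (B : CommutativeRing b ℓ′)
           (g : RingHomomorphism A (CommutativeRing.rawRing B))
           (ιA : F.Carrier → RawRing.Carrier A) (ιB : F.Carrier → CommutativeRing.Carrier B) where
    private
      module A = RawRing A
      module B = CommutativeRing B
      module DA = RawSemiringDefs A.rawSemiring
      module DB = RawSemiringDefs (RawRing.rawSemiring B.rawRing)
    open RingHomomorphism g

    ^-homo : ∀ n {x y} → ⟦ x ⟧ B.≈ y → ⟦ x DA.^ n ⟧ B.≈ y DB.^ n
    ^-homo zero    e = 1#-homo
    ^-homo (suc n) e = B.trans (*-homo _ _) (B.*-cong e (^-homo n e))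

    product-homo : ∀ n {x : Vector A.Carrier n} {y} → (∀ i → ⟦ x i ⟧ B.≈ y i) → ⟦ DA.product x ⟧ B.≈ DB.product y
    product-homo zero    e = 1#-homo
    product-homo (suc n) e = B.trans (*-homo _ _) (B.*-cong (e zero) (product-homo n (e ∘ suc)))

    -- The source is only a raw ring: the power series of the statement enter as such, and obtain
    -- their algebra from the ring into which they are mapped.
    substitute-homo : (∀ a → ⟦ ιA a ⟧ B.≈ ιB a) → ∀ {n} (p : Polynomial F n) {x y} → (∀ i → ⟦ x i ⟧ B.≈ y i) →
                      ⟦ substitute F A ιA p x ⟧ B.≈ substitute F B.rawRing ιB p y
    substitute-homo eι []            e = 0#-homo
    substitute-homo eι ((a , α) ∷ p) {x} {y} e = B.trans (+-homo _ _) (B.+-cong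
      (B.trans (*-homo _ _) (B.*-cong (eι a) (product-homo _ {λ i → x i DA.^ Vec.lookup α i} (λ i → ^-homo (Vec.lookup α i) (e i)))))
      (substitute-homo eι p e))

  module FieldProperties (em : ExcludedMiddle (c ⊔ ℓ₁)) where
    open CommutativeRing fieldRing hiding (zero)

    infix 4 _≟_
    _≟_ : Decidable _≈_
    x ≟ y = map′ lower lift (em {Lift c (x ≈ y)})

    -- A tight apartness is the negation of equality under excluded middle, and
    -- only x # 0# yields an inverse (of x - 0#).
    inverse : ExcludedMiddle ℓ₂ → Invertible₀ fieldRing
    inverse em₂ x x≉0 with em₂ {x F.# 0#}
    ... | no ¬x#0 = ⊥-elim (x≉0 (proj₁ (F.tight x 0#) ¬x#0))
    ... | yes x#0 with F.#⇒invertible x#0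
    ... | u , _ , xu≈1 = u , trans (*-congʳ (solve 1 (λ x → x := x :- con (0 , 0)) refl x)) xu≈1
      where open Solver fieldRing

    module _ (inv : Invertible₀ fieldRing) (1≉0 : ¬ (1# ≈ 0#)) where
      fieldIsDomain : IsDomain fieldRing
      fieldIsDomain = record { 1≉0 = 1≉0 ; zero-product = zero-product }
        where
        open Solver fieldRing
        open SetoidReasoning setoid
        zero-product : ∀ x y → x * y ≈ 0# → x ≈ 0# ⊎ y ≈ 0#
        zero-product x y xy≈0 with x ≟ 0#
        ... | yes x≈0 = inj₁ x≈0
        ... | no  x≉0 with inv x x≉0
        ... | u , xu≈1 = inj₂ (begin
          y            ≈⟨ *-identityˡ y ⟨
          1# * y       ≈⟨ *-congʳ xu≈1 ⟨
          (x * u) * y  ≈⟨ solve 3 (λ x u y → (x :* u) :* y := u :* (x :* y)) refl x u y ⟩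
          u * (x * y)  ≈⟨ *-congˡ xy≈0 ⟩
          u * 0#       ≈⟨ zeroʳ u ⟩
          0#           ∎)

      open Polynomials fieldRing
      open DomainPolynomials fieldRing fieldIsDomain _≟_
      open Evaluation fieldRing using (eval)
      open RawSemiringDefs (RawRing.rawSemiring rawRing) using (_^_)
      open Sums semiring using (sum; sum-cong-≋; *-distribˡ-sum)

      eval-sum : ∀ n f x → Below n f → eval id x f ≈ sum {n} (λ i → coeff f (toℕ i) * x ^ toℕ i)
      eval-sum zero    f       x f<n = eval-zero {T = fieldRing} (identityHom fieldRing) x f (Below-zero f<n)
      eval-sum (suc n) []      x f<n = sym (zeros (suc n) {λ i → x ^ toℕ i})
        where
        zeros : ∀ n {g : Vector Carrier n} → sum (λ i → 0# * g i) ≈ 0#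
        zeros n {g} = trans (sym (*-distribˡ-sum 0# g)) (zeroˡ _)
      eval-sum (suc n) (a ∷ f) x f<n = +-cong (sym (*-identityʳ a)) (begin
        x * eval id x f                                                ≈⟨ *-congˡ (eval-sum n f x (λ k n≤k → f<n (suc k) (s≤s n≤k))) ⟩
        x * sum {n} (λ i → coeff f (toℕ i) * x ^ toℕ i)               ≈⟨ *-distribˡ-sum {n} x (λ i → coeff f (toℕ i) * x ^ toℕ i) ⟩
        sum {n} (λ i → x * (coeff f (toℕ i) * x ^ toℕ i))             ≈⟨ sum-cong-≋ {n} (λ i → solve 3 (λ x a y → x :* (a :* y) := a :* (x :* y)) refl x (coeff f (toℕ i)) (x ^ toℕ i)) ⟩
        sum {n} (λ i → coeff f (toℕ i) * (x * x ^ toℕ i))             ∎)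
        where
        open Solver fieldRing
        open SetoidReasoning setoid

      module _ (closed : AlgebraicallyClosed F) where
        polynomial-root : ∀ d f → Leading (suc d) f → ∃[ x ] eval id x f ≈ 0#
        polynomial-root d f (f<d , f_d≉0) with closed d (coeff f ∘ toℕ)
          (λ e → f_d≉0 (trans (reflexive (≡.cong (coeff f) (≡.sym (Fin.toℕ-fromℕ (suc d))))) e))
        ... | x , root = x , trans (eval-sum (suc (suc d)) f x f<d) root

        -- A polynomial f of positive degree takes the value 1: f - 1 has a root.
        polynomial-nonroot : ∀ f → ¬ (f ≈ₚ []) → ∃[ x ] ¬ (eval id x f ≈ 0#)
        polynomial-nonroot f f≉0 with leading f
        ... | inj₁ f≈0 = ⊥-elim (f≉0 f≈0)
        ... | inj₂ (zero , f<1 , f₀≉0) = 0# , λ e → f₀≉0 (trans (sym (eval-constant {T = fieldRing} (identityHom fieldRing) 0# (coeff f 0)))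
                (trans (eval-cong {T = fieldRing} (identityHom fieldRing) 0# (constantₚ (coeff f 0)) f (PR.sym (Below-one f<1))) e))
          where
          module PR = CommutativeRing polyRing
        ... | inj₂ (suc d , f<d , f_d≉0) with polynomial-root d (f +ₚ constantₚ (- 1#))
                 ((λ { (suc k) d≤k → trans (shifted k) (f<d (suc k) d≤k) }) , λ e → f_d≉0 (trans (sym (shifted d)) e))
          where
          shifted : ∀ k → coeff (f +ₚ constantₚ (- 1#)) (suc k) ≈ coeff f (suc k)
          shifted k = trans (coeff-+ f (constantₚ (- 1#)) (suc k)) (+-identityʳ _)
        ... | x , root = x , λ e → 1≉0 (begin
          1#                                          ≈⟨ solve 0 (con (1 , 0) := :- (con (0 , 0) :+ :- con (1 , 0))) refl ⟩
          - (0# + - 1#)                               ≈⟨ -‿cong (+-cong e (eval-constant {T = fieldRing} (identityHom fieldRing) x (- 1#))) ⟨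
          - (eval id x f + eval id x (constantₚ (- 1#))) ≈⟨ -‿cong (eval-+ {T = fieldRing} (identityHom fieldRing) x f (constantₚ (- 1#))) ⟨
          - eval id x (f +ₚ constantₚ (- 1#))         ≈⟨ -‿cong root ⟩
          - 0#                                        ≈⟨ solve 0 (:- con (0 , 0) := con (0 , 0)) refl ⟩
          0#                                          ∎)
          where
          open Solver fieldRing
          open SetoidReasoning setoid

  module _ {a ℓ} (T : CommutativeRing a ℓ) {b} {A : Set b} (φ : A → CommutativeRing.Carrier T) where
    private
      module T = CommutativeRing T
    open Evaluation T

    eval-map : ∀ y f → eval φ y f T.≈ eval id y (List.map φ f)
    eval-map y []      = T.refl
    eval-map y (a ∷ f) = T.+-congˡ (T.*-congˡ (eval-map y f))

  coeff-map : ∀ {a ℓ b ℓ′} {R : CommutativeRing a ℓ} {T : CommutativeRing b ℓ′}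
    (φ : RingHomomorphism (CommutativeRing.rawRing R) (CommutativeRing.rawRing T)) → ∀ f k →
    CommutativeRing._≈_ T (Polynomials.coeff T (List.map (RingHomomorphism.⟦_⟧ φ) f) k)
                          (RingHomomorphism.⟦_⟧ φ (Polynomials.coeff R f k))
  coeff-map {T = T} φ []      k       = CommutativeRing.sym T (RingHomomorphism.0#-homo φ)
  coeff-map {T = T} φ (a ∷ f) zero    = CommutativeRing.refl T
  coeff-map         φ (a ∷ f) (suc k) = coeff-map φ f k

-- Algebras over the field

module Algebras {c ℓ₁ ℓ₂} (F : HeytingField c ℓ₁ ℓ₂) (em : ExcludedMiddle (c ⊔ ℓ₁)) where
  private
    K : CommutativeRing c ℓ₁
    K = fieldRing F
    module K = CommutativeRing K

  record Algebra : Set (lsuc (c ⊔ ℓ₁)) where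
    field
      ring      : CommutativeRing c (c ⊔ ℓ₁)
      structure : RingHomomorphism K.rawRing (CommutativeRing.rawRing ring)
    open CommutativeRing ring hiding (ring; zero) public
    module ι = RingHomomorphism structure

    infix 4 _≟_
    _≟_ : Decidable _≈_
    x ≟ y = em

  record AlgebraHom (A : Algebra) (T : CommutativeRing c ℓ₁) (κ : K.Carrier → CommutativeRing.Carrier T) : Set (c ⊔ ℓ₁) where
    private
      module A = Algebra A
      module T = CommutativeRing T
    field
      hom      : RingHomomorphism A.rawRing T.rawRing
      commutes : ∀ a → RingHomomorphism.⟦_⟧ hom (A.ι.⟦_⟧ a) T.≈ κ a
    open RingHomomorphism hom public

  Point : Algebra → Set (c ⊔ ℓ₁)
  Point A = AlgebraHom A K id

  _[X] : Algebra → Algebra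
  A [X] = record
    { ring      = Polynomials.polyRing A.ring
    ; structure = compose (Polynomials.polyRing A.ring) A.structure (Polynomials.constantHom A.ring)
    }
    where module A = Algebra A

  module _ {A : Algebra} {T : CommutativeRing c ℓ₁} {κ : K.Carrier → CommutativeRing.Carrier T} where
    private
      module A = Algebra A
      module T = CommutativeRing T
    open Polynomials A.ring using (constantHom; evaluation; eval-constant)

    extend : AlgebraHom A T κ → T.Carrier → AlgebraHom (A [X]) T κ
    extend φ y = record
      { hom      = evaluation {T = T} φ.hom y
      ; commutes = λ a → T.trans (eval-constant {T = T} φ.hom y (A.ι.⟦_⟧ a)) (φ.commutes a)
      }
      where module φ = AlgebraHom φ

    restrict : AlgebraHom (A [X]) T κ → AlgebraHom A T κ
    restrict φ = record
      { hom      = compose T constantHom (AlgebraHom.hom φ)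
      ; commutes = AlgebraHom.commutes φ
      }

  -- Equality is lifted to the universe level of equality in quotients of polynomial rings.
  liftedField : Algebra
  liftedField = record { ring = lifted ; structure = ringHomomorphism K lifted id lift (λ _ _ → lift K.refl) (λ _ _ → lift K.refl) (lift K.refl) }
    where
    lifted : CommutativeRing c (c ⊔ ℓ₁)
    lifted = record
      { Carrier = K.Carrier
      ; _≈_ = λ x y → Lift c (x K.≈ y)
      ; _+_ = K._+_
      ; _*_ = K._*_
      ; -_  = λ x → K.- x
      ; 0#  = K.0#
      ; 1#  = K.1#
      ; isCommutativeRing = record
        { isRing = record
          { +-isAbelianGroup = record
            { isGroup = record
              { isMonoid = record
                { isSemigroup = record
                  { isMagma = record
                    { isEquivalence = record
                      { refl  = lift K.refl
                      ; sym   = λ (lift p) → lift (K.sym p)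
                      ; trans = λ (lift p) (lift q) → lift (K.trans p q)
                      }
                    ; ∙-cong = λ (lift p) (lift q) → lift (K.+-cong p q)
                    }
                  ; assoc = λ x y z → lift (K.+-assoc x y z)
                  }
                ; identity = (λ x → lift (K.+-identityˡ x)) , λ x → lift (K.+-identityʳ x)
                }
              ; inverse = (λ x → lift (K.-‿inverseˡ x)) , λ x → lift (K.-‿inverseʳ x)
              ; ⁻¹-cong = λ (lift p) → lift (K.-‿cong p)
              }
            ; comm = λ x y → lift (K.+-comm x y)
            }
          ; *-cong = λ (lift p) (lift q) → lift (K.*-cong p q)
          ; *-assoc = λ x y z → lift (K.*-assoc x y z)
          ; *-identity = (λ x → lift (K.*-identityˡ x)) , λ x → lift (K.*-identityʳ x)
          ; distrib = (λ x y z → lift (K.distribˡ x y z)) , λ x y z → lift (K.distribʳ x y z)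
          }
        ; *-comm = λ x y → lift (K.*-comm x y)
        }
      }

  -- The ring A[X]/I, where I consists of the polynomials that h divides after
  -- multiplication by a power of its leading coefficient.
  module Adjoin (A : Algebra) (isDomain : IsDomain (Algebra.ring A)) (d : ℕ) (h : List (Algebra.Carrier A))
    (h-leading : DomainPolynomials.Leading (Algebra.ring A) isDomain (Algebra._≟_ A) (suc d) h) where
    private
      module A = Algebra A
    open Polynomials A.ring
    open PseudoDivision A.ring
    open DomainPolynomials A.ring isDomain A._≟_
    open PseudoDivisionIdentities polyRing
    open RawSemiringDefs (RawRing.rawSemiring A.rawRing) using (_^_)
    open IsDomain isDomain
    open Exp A.semiring using (^-homo-*)
    private
      module AX = CommutativeRing polyRing
      module constantHom = RingHomomorphism constantHom

    l : A.Carrier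
    l = coeff h (suc d)

    l≉0 : ¬ (l A.≈ A.0#)
    l≉0 = proj₂ h-leading

    I : Poly → Set (c ⊔ ℓ₁)
    I f = ∃[ e ] ∃[ q ] constantₚ (l ^ e) *ₚ f ≈ₚ q *ₚ h

    I-≈ : ∀ {f g} → f ≈ₚ g → I f → I g
    I-≈ f≈g (e , q , eq) = e , q , AX.trans (AX.*-congˡ {constantₚ (l ^ e)} (AX.sym f≈g)) eq

    I-0 : I []
    I-0 = 0 , [] , AX.trans (AX.zeroʳ (constantₚ A.1#)) (AX.sym (AX.zeroˡ h))

    I-+ : ∀ {f g} → I f → I g → I (f +ₚ g)
    I-+ {f} {g} (e , p , eq) (e′ , q , eq′) = e ℕ.+ e′ , constantₚ (l ^ e′) *ₚ p +ₚ constantₚ (l ^ e) *ₚ q ,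
      AX.trans (AX.*-congʳ (AX.trans (constantHom.⟦⟧-cong (^-homo-* l e e′)) (constantHom.*-homo (l ^ e) (l ^ e′))))
        (ideal-+ (constantₚ (l ^ e)) f p h (constantₚ (l ^ e′)) g q eq eq′)

    I-* : ∀ f {g} → I g → I (f *ₚ g)
    I-* f {g} (e , q , eq) = e , f *ₚ q , ideal-* (constantₚ (l ^ e)) g q h f eq

    ideal : Ideal polyRing (c ⊔ ℓ₁)
    ideal = record
      { I   = I
      ; I-≈ = λ {f} {g} → I-≈ {f} {g}
      ; I-0 = I-0
      ; I-+ = λ {f} {g} → I-+ {f} {g}
      ; I-* = λ f {g} → I-* f {g}
      }

    open QuotientRing polyRing ideal

    -- In l^e f = q h a nonzero q would force degree at least suc d. In particular 1 is not in I.
    I-below : ∀ f → Below (suc d) f → I f → f ≈ₚ []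
    I-below f f<d (e , q , eq) with leading q
    ... | inj₁ q≈0 = constant-*-≈0 {l ^ e} {f} (^-≉0 l≉0 e) (AX.trans eq (AX.trans (AX.*-congʳ q≈0) (AX.zeroˡ h)))
    ... | inj₂ (s , lead) = ⊥-elim (Leading-* {s} {suc d} {q} {h} lead h-leading
      (A.trans (A.sym (coeff-≈ eq (s ℕ.+ suc d))) (Below-constant-* (l ^ e) {f} f<d (s ℕ.+ suc d) (ℕ.m≤n+m (suc d) s))))

    Below-constant : ∀ a → Below (suc d) (constantₚ a)
    Below-constant a (suc k) _ = A.refl

    adjunction : Algebra
    adjunction = record
      { ring      = quotientRing
      ; structure = ringHomomorphism K quotientRing (λ a → constantₚ (A.ι.⟦_⟧ a))
          (λ p → ≈⇒≈ᵢ (AX-ι.⟦⟧-cong p)) (λ x y → ≈⇒≈ᵢ (AX-ι.+-homo x y)) (λ x y → ≈⇒≈ᵢ (AX-ι.*-homo x y)) (≈⇒≈ᵢ AX-ι.1#-homo)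
      }
      where module AX-ι = Algebra.ι (A [X])

    module _ {T : CommutativeRing c ℓ₁} {κ : K.Carrier → CommutativeRing.Carrier T} where
      private
        module T = CommutativeRing T

      module _ (φ : AlgebraHom A T κ)
               (cancel : ∀ e x → AlgebraHom.⟦_⟧ φ (l ^ e) T.* x T.≈ T.0# → x T.≈ T.0#) (y : T.Carrier)
               (root : Evaluation.eval T (AlgebraHom.⟦_⟧ φ) y h T.≈ T.0#) where

        open AlgebraHom φ

        -- l^e f = q h goes to zero, and `cancel` removes the power of l: in the field because l is
        -- nonzero at the point, in the power series because its image is a unit.
        I-vanishes : ∀ {f} → I f → AlgebraHom.⟦_⟧ (extend {A} φ y) f T.≈ T.0#
        I-vanishes {f} (e , q , eq) = cancel e (ev f) (begin
          ⟦ l ^ e ⟧ T.* ev f                    ≈⟨ T.*-congʳ (eval-constant {T = T} hom y (l ^ e)) ⟨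
          ev (constantₚ (l ^ e)) T.* ev f       ≈⟨ eval-* {T = T} hom y (constantₚ (l ^ e)) f ⟨
          ev (constantₚ (l ^ e) *ₚ f)           ≈⟨ eval-cong {T = T} hom y (constantₚ (l ^ e) *ₚ f) (q *ₚ h) eq ⟩
          ev (q *ₚ h)                           ≈⟨ eval-* {T = T} hom y q h ⟩
          ev q T.* ev h                         ≈⟨ T.*-congˡ root ⟩
          ev q T.* T.0#                         ≈⟨ T.zeroʳ _ ⟩
          T.0#                                  ∎)
          where
          open SetoidReasoning T.setoid
          ev : Poly → T.Carrier
          ev = AlgebraHom.⟦_⟧ (extend {A} φ y)

        extend-root : AlgebraHom adjunction T κ
        extend-root = record
          { hom      = factor {T = T} (AlgebraHom.hom (extend {A} φ y)) (λ {f} → I-vanishes {f})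
          ; commutes = AlgebraHom.commutes (extend {A} φ y)
          }

      restrict-root : AlgebraHom adjunction T κ → AlgebraHom (A [X]) T κ
      restrict-root φ = record
        { hom      = ringHomomorphism polyRing T φ.⟦_⟧ (λ p → φ.⟦⟧-cong (≈⇒≈ᵢ p)) φ.+-homo φ.*-homo φ.1#-homo
        ; commutes = φ.commutes
        }
        where module φ = AlgebraHom φ

    -- A pointwise substitute for h dividing a b: wherever c does not vanish, every root of h is a
    -- root of a or of b.
    Splits : Poly → Poly → A.Carrier → Set (c ⊔ ℓ₁)
    Splits a b c = ∀ (χ : Point A) → ¬ (AlgebraHom.⟦_⟧ χ c K.≈ K.0#) → ∀ y → vanishes χ y h → vanishes χ y a ⊎ vanishes χ y b
      where
      vanishes : Point A → K.Carrier → Poly → Set ℓ₁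
      vanishes χ y f = Evaluation.eval K (AlgebraHom.⟦_⟧ χ) y f K.≈ K.0#

    -- Excludes factorisations of nonzero multiples of h, since these split at points. The pointwise
    -- form is the one that minimality of h yields, and primality of I follows from it directly.
    Irreducible : Set (c ⊔ ℓ₁)
    Irreducible = ∀ a b c → ¬ (a ≈ₚ []) → ¬ (b ≈ₚ []) → Below (suc d) a → Below (suc d) b → ¬ (c A.≈ A.0#) → ¬ Splits a b c

-- Domains with densely many maps to the power series

module Germs {c ℓ₁ ℓ₂} (F : HeytingField c ℓ₁ ℓ₂) (em : ExcludedMiddle (c ⊔ ℓ₁))
  (inverse : Invertible₀ (fieldRing F)) (closed : AlgebraicallyClosed F) (char0 : CharacteristicZero F)
  (P : CommutativeRing c ℓ₁)
  (κ : RingHomomorphism (CommutativeRing.rawRing (fieldRing F)) (CommutativeRing.rawRing P))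
  (ε : RingHomomorphism (CommutativeRing.rawRing P) (CommutativeRing.rawRing (fieldRing F)))
  (εκ≈id : ∀ a → HeytingField._≈_ F (RingHomomorphism.⟦_⟧ ε (RingHomomorphism.⟦_⟧ κ a)) a)
  (henselian : Hensel.Henselian (fieldRing F) inverse P ε) where

  open Algebras F em
  private
    K : CommutativeRing c ℓ₁
    K = fieldRing F
    module K = CommutativeRing K
    module P = CommutativeRing P
    module κ = RingHomomorphism κ
    module ε = RingHomomorphism ε
    module KX = Polynomials K
  open FieldProperties F em using (fieldIsDomain; polynomial-root; polynomial-nonroot)
  open Evaluation using (eval; quotient; eval-congˡ)

  K-1≉0 : ¬ (K.1# K.≈ K.0#)
  K-1≉0 e = char0 0 (K.trans (K.+-identityʳ K.1#) e)

  K-isDomain : IsDomain K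
  K-isDomain = fieldIsDomain inverse K-1≉0

  open IsDomain K-isDomain using () renaming (zero-product to K-zero-product; *-≉0 to K-*-≉0)

  residue : ∀ {A} → AlgebraHom A P κ.⟦_⟧ → Point A
  residue φ = record
    { hom      = compose K φ.hom ε
    ; commutes = λ a → K.trans (ε.⟦⟧-cong (φ.commutes a)) (εκ≈id a)
    }
    where module φ = AlgebraHom φ

  -- In the application `w` consists of the variables of the power series, so that a germ is a
  -- Taylor expansion at `centre` on the coordinates z, extended to the adjoined elements.
  record Germ (A : Algebra) {n} (z : Vector (Algebra.Carrier A) n) (w : Vector P.Carrier n) : Set (c ⊔ ℓ₁) where
    field
      algebraHom : AlgebraHom A P κ.⟦_⟧
      centre     : Vector K.Carrier n
    open AlgebraHom algebraHom public
    field
      translates : ∀ i → ⟦ z i ⟧ P.≈ w i P.+ κ.⟦ centre i ⟧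

  -- Over the Henselian ring P a nonzero residue is the same as being a unit. Stated with residues,
  -- `dense` also provides points of the algebra over the field.
  record GenericDomain {n} (w : Vector P.Carrier n) : Set (lsuc (c ⊔ ℓ₁)) where
    field
      algebra  : Algebra
      isDomain : IsDomain (Algebra.ring algebra)
    open Algebra algebra public
    field
      z     : Vector Carrier n
      dense : ∀ x → ¬ (x ≈ 0#) → Σ[ φ ∈ Germ algebra z w ] ¬ (ε.⟦ Germ.⟦_⟧ φ x ⟧ K.≈ K.0#)
    module Poly = Polynomials ring
    module DomainPoly = DomainPolynomials ring isDomain _≟_

  module _ {A : Algebra} (χ : Point A) where
    private
      module A = Algebra A
      module AX = Polynomials A.ring
    open AlgebraHom χ

    eval-≉0 : ∀ f {p} → ¬ (⟦ AX.coeff f p ⟧ K.≈ K.0#) → ∃[ x ] ¬ (eval K ⟦_⟧ x f K.≈ K.0#)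
    eval-≉0 f {p} fₚ≉0 with polynomial-nonroot inverse K-1≉0 closed (List.map ⟦_⟧ f)
      (λ e → fₚ≉0 (K.trans (K.sym (coeff-map F {T = K} hom f p)) (KX.coeff-≈ e p)))
    ... | x , f[x]≉0 = x , λ e → f[x]≉0 (K.trans (K.sym (eval-map F K ⟦_⟧ x f)) e)

    specialised-root : ∀ d f → AX.Below (suc (suc d)) f → ¬ (⟦ AX.coeff f (suc d) ⟧ K.≈ K.0#) →
                       ∃[ x ] eval K ⟦_⟧ x f K.≈ K.0#
    specialised-root d f f<d f_d≉0 with polynomial-root inverse K-1≉0 closed d (List.map ⟦_⟧ f)
      ((λ k d≤k → K.trans (coeff-map F {T = K} hom f k) (K.trans (⟦⟧-cong (f<d k d≤k)) 0#-homo)) ,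
       λ e → f_d≉0 (K.trans (K.sym (coeff-map F {T = K} hom f (suc d))) e))
    ... | x , root = x , K.trans (eval-map F K ⟦_⟧ x f) root

    nonzero-left : ∀ x y → ¬ (⟦ x A.* y ⟧ K.≈ K.0#) → ¬ (⟦ x ⟧ K.≈ K.0#)
    nonzero-left x y xy≉0 e = xy≉0 (K.trans (*-homo x y) (K.trans (K.*-congʳ e) (K.zeroˡ _)))

    nonzero-right : ∀ x y → ¬ (⟦ x A.* y ⟧ K.≈ K.0#) → ¬ (⟦ y ⟧ K.≈ K.0#)
    nonzero-right x y xy≉0 e = xy≉0 (K.trans (*-homo x y) (K.trans (K.*-congˡ e) (K.zeroʳ _)))

    open RawSemiringDefs (RawRing.rawSemiring A.rawRing) using (_^_)

    power-≉0 : ∀ {a} → ¬ (⟦ a ⟧ K.≈ K.0#) → ∀ e → ¬ (⟦ a ^ e ⟧ K.≈ K.0#)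
    power-≉0     a≉0 zero    p = K-1≉0 (K.trans (K.sym 1#-homo) p)
    power-≉0 {a} a≉0 (suc e) p = K-*-≉0 a≉0 (power-≉0 a≉0 e) (K.trans (K.sym (*-homo a (a ^ e))) p)

  module Transcendental {n} {w : Vector P.Carrier n} (D : GenericDomain w) where
    open GenericDomain D
    open Poly using (constantₚ; coeff; eval-constant)

    lift-germ : (φ : Germ algebra z w) → P.Carrier → AlgebraHom (algebra [X]) P κ.⟦_⟧
    lift-germ φ y = extend {algebra} (Germ.algebraHom φ) y

    -- A germ that keeps the leading coefficient of f nonzero is combined with a field element x
    -- that is no root of the specialised f. Any value of residue x will do for the new variable;
    -- the shape y plus a constant serves an adjoined unknown (y = 0) as well as a new coordinate (y
    -- its series variable).
    dense-extend : ∀ (y : P.Carrier) f → ¬ (f Poly.≈ₚ []) → Σ[ φ ∈ Germ algebra z w ] ∃[ a ]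
                   ¬ (ε.⟦ AlgebraHom.⟦_⟧ (lift-germ φ (y P.+ κ.⟦ a ⟧)) f ⟧ K.≈ K.0#)
    dense-extend y f f≉0 with DomainPoly.leading f
    ... | inj₁ f≈0 = ⊥-elim (f≉0 f≈0)
    ... | inj₂ (p , _ , fₚ≉0) with dense (coeff f p) fₚ≉0
    ... | φ , φfₚ≉0 with eval-≉0 {algebra} (residue (Germ.algebraHom φ)) f {p} φfₚ≉0
    -- The constant is chosen to give y plus the constant the residue x.
    ... | x , f[x]≉0 = φ , x K.- ε.⟦ y ⟧ , λ e → f[x]≉0 (K.trans (K.sym (K.trans (eval-homo ε φ.⟦_⟧ y′ f)
        (eval-congˡ K _ f residue-y′))) e)
      where
      module φ = Germ φ
      y′ : P.Carrier
      y′ = y P.+ κ.⟦ x K.- ε.⟦ y ⟧ ⟧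
      residue-y′ : ε.⟦ y′ ⟧ K.≈ x
      residue-y′ = K.trans (ε.+-homo _ _) (K.trans (K.+-congˡ (εκ≈id _)) (K.sym (Evaluation.telescope K x ε.⟦ y ⟧)))

    transcendental : GenericDomain w
    transcendental = record
      { algebra  = algebra [X]
      ; isDomain = DomainPoly.polyIsDomain
      ; z        = constantₚ ∘ z
      ; dense    = λ f f≉0 → let φ , a , φf≉0 = dense-extend P.0# f f≉0 in
          record
            { algebraHom = lift-germ φ (P.0# P.+ κ.⟦ a ⟧)
            ; centre     = Germ.centre φ
            ; translates = λ i → P.trans (eval-constant {T = P} (Germ.hom φ) _ (z i)) (Germ.translates φ i)
            } , φf≉0
      }

  new-coordinate : ∀ {n} (w : Vector P.Carrier (suc n)) → GenericDomain (w ∘ suc) → GenericDomain w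
  new-coordinate w D = record
    { algebra  = algebra [X]
    ; isDomain = DomainPoly.polyIsDomain
    ; z        = X Vector.∷ (constantₚ ∘ z)
    ; dense    = λ f f≉0 → let φ , a , φf≉0 = dense-extend (w zero) f f≉0 in
        record
          { algebraHom = lift-germ φ (w zero P.+ κ.⟦ a ⟧)
          ; centre     = a Vector.∷ Germ.centre φ
          ; translates = λ { zero    → eval-X {T = P} (Germ.hom φ) _
                           ; (suc i) → P.trans (eval-constant {T = P} (Germ.hom φ) _ (z i)) (Germ.translates φ i) }
          } , φf≉0
    }
    where
    open GenericDomain D
    open Poly using (constantₚ; X; eval-constant; eval-X)
    open Transcendental D

  polynomials : ∀ n (w : Vector P.Carrier n) → GenericDomain w
  polynomials zero w = record
    { algebra  = liftedField
    ; isDomain = record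
      { 1≉0 = λ (lift e) → K-1≉0 e
      ; zero-product = λ x y (lift e) → Sum.map lift lift (K-zero-product x y e)
      }
    ; z        = λ ()
    ; dense    = λ x x≉0 → record
        { algebraHom = record
          { hom = ringHomomorphism (Algebra.ring liftedField) P κ.⟦_⟧ (λ (lift e) → κ.⟦⟧-cong e) κ.+-homo κ.*-homo κ.1#-homo
          ; commutes = λ a → P.refl
          }
        ; centre = λ ()
        ; translates = λ ()
        } , λ e → x≉0 (lift (K.trans (K.sym (εκ≈id x)) e))
    }
  polynomials (suc n) w = new-coordinate w (polynomials n (w ∘ suc))

  module Algebraic {n} {w : Vector P.Carrier n} (D : GenericDomain w) (d : ℕ) (h : List (GenericDomain.Carrier D))
    (h-leading : GenericDomain.DomainPoly.Leading D (suc d) h)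
    (irreducible : Adjoin.Irreducible (GenericDomain.algebra D) (GenericDomain.isDomain D) d h h-leading) where

    open GenericDomain D
    open Poly
    open Adjoin algebra isDomain d h h-leading
    open IsDomain isDomain using (*-≉0; 1≉0)
    open PseudoDivision ring
    open DomainPoly using (bezout-below)
    open RawSemiringDefs (RawRing.rawSemiring rawRing) using (_^_) renaming (_×_ to _·_)
    private
      module AX = CommutativeRing polyRing
      module B = Algebra adjunction

    module _ (χ : Point algebra) (y : K.Carrier) (root : eval K (AlgebraHom.⟦_⟧ χ) y h K.≈ K.0#) where
      open AlgebraHom χ
      private
        ev : Poly.Poly → K.Carrier
        ev = eval K ⟦_⟧ y

      eval-multiple : ∀ q → ev (q *ₚ h) K.≈ K.0#
      eval-multiple q = K.trans (eval-* {T = K} hom y q h) (K.trans (K.*-congˡ root) (K.zeroʳ _))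

      eval-combination : ∀ u f v → ev (u *ₚ f +ₚ v *ₚ h) K.≈ ev u K.* ev f
      eval-combination u f v = K.trans (eval-+ {T = K} hom y (u *ₚ f) (v *ₚ h))
        (K.trans (K.+-cong (eval-* {T = K} hom y u f) (eval-multiple v)) (K.+-identityʳ _))

      -- At a root y of h the identity becomes u(y) f(y) = ρ.
      eval-bezout : ∀ u f v ρ → ¬ (⟦ ρ ⟧ K.≈ K.0#) → u *ₚ f +ₚ v *ₚ h ≈ₚ constantₚ ρ → ¬ (ev f K.≈ K.0#)
      eval-bezout u f v ρ ρ≉0 eq f≈0 = ρ≉0 (begin
        ⟦ ρ ⟧                        ≈⟨ eval-constant {T = K} hom y ρ ⟨
        ev (constantₚ ρ)             ≈⟨ eval-cong {T = K} hom y (u *ₚ f +ₚ v *ₚ h) (constantₚ ρ) eq ⟨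
        ev (u *ₚ f +ₚ v *ₚ h)        ≈⟨ eval-combination u f v ⟩
        ev u K.* ev f                ≈⟨ K.*-congˡ f≈0 ⟩
        ev u K.* K.0#                ≈⟨ K.zeroʳ _ ⟩
        K.0#                         ∎)
        where open SetoidReasoning K.setoid

      eval-remainder : ∀ a f q r → constantₚ a *ₚ f ≈ₚ q *ₚ h +ₚ r → ev r K.≈ ⟦ a ⟧ K.* ev f
      eval-remainder a f q r eq = begin
        ev r                            ≈⟨ K.+-identityˡ _ ⟨
        K.0# K.+ ev r                   ≈⟨ K.+-congʳ (eval-multiple q) ⟨
        ev (q *ₚ h) K.+ ev r            ≈⟨ eval-+ {T = K} hom y (q *ₚ h) r ⟨
        ev (q *ₚ h +ₚ r)                ≈⟨ eval-cong {T = K} hom y (constantₚ a *ₚ f) (q *ₚ h +ₚ r) eq ⟨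
        ev (constantₚ a *ₚ f)           ≈⟨ eval-* {T = K} hom y (constantₚ a) f ⟩
        ev (constantₚ a) K.* ev f       ≈⟨ K.*-congʳ (eval-constant {T = K} hom y a) ⟩
        ⟦ a ⟧ K.* ev f                  ∎
        where open SetoidReasoning K.setoid

      extend-point : ¬ (⟦ l ⟧ K.≈ K.0#) → Point adjunction
      extend-point l≉0 = extend-root {T = K} χ cancel y root
        where
        cancel : ∀ e x → ⟦ l ^ e ⟧ K.* x K.≈ K.0# → x K.≈ K.0#
        cancel e x p with K-zero-product ⟦ l ^ e ⟧ x p
        ... | inj₁ q = ⊥-elim (power-≉0 {algebra} χ l≉0 e q)
        ... | inj₂ q = q

    remainder-≉0 : ∀ {f} e q r → ¬ I f → constantₚ (l ^ e) *ₚ f ≈ₚ q *ₚ h +ₚ r → ¬ (r ≈ₚ [])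
    remainder-≉0 e q r f∉I eq r≈0 = f∉I (e , q , AX.trans eq (AX.trans (AX.+-congˡ {q *ₚ h} r≈0) (AX.+-identityʳ (q *ₚ h))))

    -- If neither f nor g were in I, their remainders modulo h would be nonzero of smaller degree.
    -- At a root y of h over a point with l nonzero, f(y) g(y) = 0, so one of the remainders
    -- vanishes; this is a splitting of h.
    I-prime : ∀ f g → I (f *ₚ g) → I f ⊎ I g
    I-prime f g (e , q , eq) with em {I f} | em {I g}
    ... | yes f∈I | _ = inj₁ f∈I
    ... | no _ | yes g∈I = inj₂ g∈I
    ... | no f∉I | no g∉I with pseudo-division (suc d) h (proj₁ h-leading) f | pseudo-division (suc d) h (proj₁ h-leading) g
    ... | e₁ , q₁ , r₁ , r₁<d , eq₁ | e₂ , q₂ , r₂ , r₂<d , eq₂ =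
      ⊥-elim (irreducible r₁ r₂ l (remainder-≉0 {f} e₁ q₁ r₁ f∉I eq₁) (remainder-≉0 {g} e₂ q₂ r₂ g∉I eq₂) r₁<d r₂<d l≉0 splits)
      where
      splits : Splits r₁ r₂ l
      splits χ χl≉0 y root = pick (K-zero-product _ _ (K.trans (K.*-assoc _ _ _) product≈0))
        where
        open AlgebraHom χ
        ev : Poly.Poly → K.Carrier
        ev = eval K ⟦_⟧ y
        product≈0 : ⟦ l ^ e ⟧ K.* (ev f K.* ev g) K.≈ K.0#
        product≈0 = K.trans (K.sym (K.trans (eval-* {T = K} hom y (constantₚ (l ^ e)) (f *ₚ g))
            (K.*-cong (eval-constant {T = K} hom y (l ^ e)) (eval-* {T = K} hom y f g))))
          (K.trans (eval-cong {T = K} hom y (constantₚ (l ^ e) *ₚ (f *ₚ g)) (q *ₚ h) eq) (eval-multiple χ y root q))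
        vanish₂ : ev g K.≈ K.0# → ev r₂ K.≈ K.0#
        vanish₂ p = K.trans (eval-remainder χ y root (l ^ e₂) g q₂ r₂ eq₂) (K.trans (K.*-congˡ p) (K.zeroʳ _))
        vanish₁ : ev f K.≈ K.0# → ev r₁ K.≈ K.0#
        vanish₁ p = K.trans (eval-remainder χ y root (l ^ e₁) f q₁ r₁ eq₁) (K.trans (K.*-congˡ p) (K.zeroʳ _))
        pick : ⟦ l ^ e ⟧ K.* ev f K.≈ K.0# ⊎ ev g K.≈ K.0# → ev r₁ K.≈ K.0# ⊎ ev r₂ K.≈ K.0#
        pick (inj₂ p) = inj₂ (vanish₂ p)
        pick (inj₁ p) with K-zero-product _ _ p
        ... | inj₁ p′ = ⊥-elim (power-≉0 {algebra} χ χl≉0 e p′)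
        ... | inj₂ p′ = inj₁ (vanish₁ p′)

    open QuotientRing polyRing ideal

    adjunction-isDomain : IsDomain B.ring
    adjunction-isDomain = record
      { 1≉0 = λ e → 1≉0 (coeff-≈ (I-below AX.1# (Below-constant 1#) (≈0⇒I e)) 0)
      ; zero-product = λ f g e → Sum.map I⇒≈0 I⇒≈0 (I-prime f g (≈0⇒I e))
      }

    no-factorization : ∀ a b c → ¬ (a ≈ₚ []) → ¬ (b ≈ₚ []) → Below (suc d) a → Below (suc d) b → ¬ (c ≈ 0#) →
                       ¬ (constantₚ c *ₚ h ≈ₚ a *ₚ b)
    no-factorization a b c a≉0 b≉0 a<d b<d c≉0 eq = irreducible a b c a≉0 b≉0 a<d b<d c≉0 λ χ _ y root →
      K-zero-product _ _ (K.trans (K.sym (eval-* {T = K} (AlgebraHom.hom χ) y a b))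
        (K.trans (eval-cong {T = K} (AlgebraHom.hom χ) y (a *ₚ b) (constantₚ c *ₚ h) (AX.sym eq)) (eval-multiple χ y root (constantₚ c))))

    bezout : ∀ m → Below (suc d) m → ¬ (m ≈ₚ []) → ∃[ u ] ∃[ v ] ∃[ ρ ] ¬ (ρ ≈ 0#) × u *ₚ m +ₚ v *ₚ h ≈ₚ constantₚ ρ
    bezout m m<d m≉0 = bezout-below {suc d} {h} h-leading no-factorization (suc d) m ℕ.≤-refl m<d m≉0

    -- Outside I an element is invertible modulo h up to a nonzero ρ of the old ring. Thus
    -- nonvanishing of f in the new ring is controlled by density in the old one.
    bezout-mod : ∀ f → ¬ I f → ∃[ u ] ∃[ v ] ∃[ ρ ] ¬ (ρ ≈ 0#) × u *ₚ f +ₚ v *ₚ h ≈ₚ constantₚ ρ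
    bezout-mod f f∉I with pseudo-division (suc d) h (proj₁ h-leading) f
    ... | e , q , r , r<d , eq with bezout r r<d (remainder-≉0 {f} e q r f∉I eq)
    ... | u , v , ρ , ρ≉0 , eq′ = u *ₚ constantₚ (l ^ e) , v AX.- u *ₚ q , ρ , ρ≉0 ,
      PseudoDivisionIdentities.bezout-lift polyRing u v (constantₚ (l ^ e)) q f h r (constantₚ ρ) eq eq′

    module KM = RawSemiringDefs (RawRing.rawSemiring K.rawRing)

    ·≈ι* : ∀ k x → k · x ≈ ι.⟦ k KM.× K.1# ⟧ * x
    ·≈ι* zero    x = sym (trans (*-congʳ ι.0#-homo) (zeroˡ x))
    ·≈ι* (suc k) x = begin
      x + k · x                                                ≈⟨ +-cong (*-identityˡ x) (sym (·≈ι* k x)) ⟨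
      1# * x + ι.⟦ k KM.× K.1# ⟧ * x                           ≈⟨ distribʳ _ _ _ ⟨
      (1# + ι.⟦ k KM.× K.1# ⟧) * x                             ≈⟨ *-congʳ (+-congʳ ι.1#-homo) ⟨
      (ι.⟦ K.1# ⟧ + ι.⟦ k KM.× K.1# ⟧) * x                     ≈⟨ *-congʳ (ι.+-homo _ _) ⟨
      ι.⟦ suc k KM.× K.1# ⟧ * x                                ∎
      where open SetoidReasoning setoid

    ι-≉0 : ∀ a → ¬ (a K.≈ K.0#) → ¬ (ι.⟦ a ⟧ ≈ 0#)
    ι-≉0 a a≉0 e with inverse a a≉0
    ... | u , au≈1 = 1≉0 (trans (sym ι.1#-homo) (trans (ι.⟦⟧-cong (K.sym au≈1)) (trans (ι.*-homo a u) (trans (*-congʳ e) (zeroˡ _)))))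

    derivative-below : Below (suc d) (derivative h)
    derivative-below k d<k = trans (coeff-derivative h k) (trans (·≈ι* (suc k) _) (trans (*-congˡ (proj₁ h-leading (suc k) (s≤s d<k))) (zeroʳ _)))

    -- The coefficient in degree d is (d + 1) l, and d + 1 is nonzero in characteristic zero. So the
    -- derivative has a Bezout identity with h, and roots of h are generically simple.
    derivative-≉0 : ¬ (derivative h ≈ₚ [])
    derivative-≉0 e = *-≉0 (ι-≉0 (suc d KM.× K.1#) (char0 d)) l≉0
      (trans (sym (·≈ι* (suc d) l)) (trans (sym (coeff-derivative h d)) (coeff-≈ e d)))

    Dense : Poly.Poly → Set (c ⊔ ℓ₁)
    Dense f = Σ[ φ ∈ Germ adjunction (constantₚ ∘ z) w ] ¬ (ε.⟦ Germ.⟦_⟧ φ f ⟧ K.≈ K.0#)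

    module _ (f u v : Poly.Poly) (ρ : Carrier) (f-bezout : u *ₚ f +ₚ v *ₚ h ≈ₚ constantₚ ρ)
             (u′ v′ : Poly.Poly) (δ : Carrier) (h-bezout : u′ *ₚ derivative h +ₚ v′ *ₚ h ≈ₚ constantₚ δ)
             (φ : Germ algebra z w) (φσ≉0 : ¬ (ε.⟦ Germ.⟦_⟧ φ (l * (ρ * δ)) ⟧ K.≈ K.0#)) where
      private
        module φ = Germ φ

        χ : Point algebra
        χ = residue {algebra} φ.algebraHom
        module χ = AlgebraHom χ

        χl≉0 : ¬ (χ.⟦ l ⟧ K.≈ K.0#)
        χl≉0 = nonzero-left {algebra} χ l (ρ * δ) φσ≉0
        χρ≉0 : ¬ (χ.⟦ ρ ⟧ K.≈ K.0#)
        χρ≉0 = nonzero-left {algebra} χ ρ δ (nonzero-right {algebra} χ l (ρ * δ) φσ≉0)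
        χδ≉0 : ¬ (χ.⟦ δ ⟧ K.≈ K.0#)
        χδ≉0 = nonzero-right {algebra} χ ρ δ (nonzero-right {algebra} χ l (ρ * δ) φσ≉0)

        residue-root : ∃[ y₀ ] eval K χ.⟦_⟧ y₀ h K.≈ K.0#
        residue-root = specialised-root {algebra} χ d h (proj₁ h-leading) χl≉0

        y₀ : K.Carrier
        y₀ = proj₁ residue-root

        simple : ¬ (quotient K χ.⟦_⟧ y₀ y₀ h K.≈ K.0#)
        simple e = eval-bezout χ y₀ (proj₂ residue-root) u′ (derivative h) v′ δ χδ≉0 h-bezout
          (K.trans (eval-derivative {T = K} χ.hom y₀ h) e)

        root : ∃[ y ] eval P φ.⟦_⟧ y h P.≈ P.0# × ε.⟦ y ⟧ K.≈ y₀
        root = henselian φ.⟦_⟧ h y₀ (proj₂ residue-root) simple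

        y : P.Carrier
        y = proj₁ root

        cancel : ∀ e x → φ.⟦ l ^ e ⟧ P.* x P.≈ P.0# → x P.≈ P.0#
        cancel e x p = let i , li≈1 = Hensel.invertible K inverse {P} {ε} henselian φ.⟦ l ^ e ⟧ (power-≉0 {algebra} χ χl≉0 e) in begin
          x                               ≈⟨ P.*-identityˡ x ⟨
          P.1# P.* x                      ≈⟨ P.*-congʳ li≈1 ⟨
          (φ.⟦ l ^ e ⟧ P.* i) P.* x       ≈⟨ P.*-congʳ (P.*-comm _ i) ⟩
          (i P.* φ.⟦ l ^ e ⟧) P.* x       ≈⟨ P.*-assoc i _ x ⟩
          i P.* (φ.⟦ l ^ e ⟧ P.* x)       ≈⟨ P.*-congˡ p ⟩
          i P.* P.0#                      ≈⟨ P.zeroʳ i ⟩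
          P.0#                            ∎
          where open SetoidReasoning P.setoid

      lifted-germ : Dense f
      lifted-germ = record
        { algebraHom = extend-root {T = P} φ.algebraHom cancel y (proj₁ (proj₂ root))
        ; centre     = φ.centre
        ; translates = λ i → P.trans (eval-constant {T = P} φ.hom y (z i)) (φ.translates i)
        } , λ e → eval-bezout χ y₀ (proj₂ residue-root) u f v ρ χρ≉0 f-bezout
          (K.trans (K.sym (K.trans (eval-homo ε φ.⟦_⟧ y f) (eval-congˡ K χ.⟦_⟧ f (proj₂ (proj₂ root))))) e)

    adjunction-dense : ∀ f → ¬ I f → Dense f
    adjunction-dense f f∉I =
      let u  , v  , ρ , ρ≉0 , f-bezout = bezout-mod f f∉I
          u′ , v′ , δ , δ≉0 , h-bezout = bezout (derivative h) derivative-below derivative-≉0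
          -- Nonvanishing of l keeps the degree of h, so that a root exists, and makes powers of l
          -- cancellable; that of δ makes the root simple; that of ρ keeps f nonzero there.
          φ , φσ≉0 = dense (l * (ρ * δ)) (*-≉0 l≉0 (*-≉0 ρ≉0 δ≉0))
      in lifted-germ f u v ρ f-bezout u′ v′ δ h-bezout φ φσ≉0

    algebraic : GenericDomain w
    algebraic = record
      { algebra  = adjunction
      ; isDomain = adjunction-isDomain
      ; z        = constantₚ ∘ z
      ; dense    = λ f f≉0 → adjunction-dense f (λ f∈I → f≉0 (I⇒≈0 f∈I))
      }

-- Adjoining a generic solution

-- Defined so that moving one entry across the sum is definitional; fill k c y
-- lists the entries of c in reverse order, followed by y.
infixl 6 _+ʳ_
_+ʳ_ : ℕ → ℕ → ℕ
zero  +ʳ j = j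
suc k +ʳ j = k +ʳ suc j

fill : ∀ {a} {A : Set a} k {j} → Vector A k → Vector A j → Vector A (k +ʳ j)
fill zero    c y = y
fill (suc k) c y = fill k (c ∘ suc) (c zero Vector.∷ y)

fill-pointwise : ∀ {a b ℓ} {A : Set a} {B : Set b} (_~_ : A → B → Set ℓ) k {j} {c : Vector A k} {c′ : Vector B k}
                 {y : Vector A j} {y′ : Vector B j} → (∀ i → c i ~ c′ i) → (∀ i → y i ~ y′ i) →
                 ∀ i → fill k c y i ~ fill k c′ y′ i
fill-pointwise _~_ zero    c~ y~ = y~
fill-pointwise _~_ (suc k) c~ y~ = fill-pointwise _~_ k (c~ ∘ suc) λ { zero → c~ zero ; (suc i) → y~ i }

module Elimination {c ℓ₁ ℓ₂} (F : HeytingField c ℓ₁ ℓ₂) (em : ExcludedMiddle (c ⊔ ℓ₁))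
  (inverse : Invertible₀ (fieldRing F)) (closed : AlgebraicallyClosed F) (char0 : CharacteristicZero F)
  (P : CommutativeRing c ℓ₁)
  (κ : RingHomomorphism (CommutativeRing.rawRing (fieldRing F)) (CommutativeRing.rawRing P))
  (ε : RingHomomorphism (CommutativeRing.rawRing P) (CommutativeRing.rawRing (fieldRing F)))
  (εκ≈id : ∀ a → HeytingField._≈_ F (RingHomomorphism.⟦_⟧ ε (RingHomomorphism.⟦_⟧ κ a)) a)
  (henselian : Hensel.Henselian (fieldRing F) inverse P ε)
  {n m} (w : Vector (CommutativeRing.Carrier P) n) (L : PolynomialMap F n m) where

  open Algebras F em
  open Germs F em inverse closed char0 P κ ε εκ≈id henselian
  open Evaluation using (eval)
  private
    K : CommutativeRing c ℓ₁
    K = fieldRing F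
    module K = CommutativeRing K
    module P = CommutativeRing P

  module _ {r} (M : PolynomialMap F r m) (T : CommutativeRing c ℓ₁) (κT : K.Carrier → CommutativeRing.Carrier T) where
    private
      module T = CommutativeRing T

    Solves : Vector T.Carrier r → Vector T.Carrier n → Set ℓ₁
    Solves y z = ∀ i → substitute F T.rawRing κT (M i) y T.≈ substitute F T.rawRing κT (L i) z

    Solves-cong : ∀ {y y′ z z′} → (∀ i → y i T.≈ y′ i) → (∀ i → z i T.≈ z′ i) → Solves y z → Solves y′ z′
    Solves-cong y≈ z≈ s i = T.trans (T.sym (cong (M i) y≈)) (T.trans (s i) (cong (L i) z≈))
      where
      cong : ∀ {k} (p : Polynomial F k) {x y} → (∀ i → x i T.≈ y i) →
             substitute F T.rawRing κT p x T.≈ substitute F T.rawRing κT p y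
      cong = substitute-homo F T (identityHom T) κT κT (λ _ → T.refl)

  module _ {k j} (M : PolynomialMap F (k +ʳ j) m) (D : GenericDomain w) (chosen : Vector (GenericDomain.Carrier D) k) where
    open GenericDomain D

    SolvesAt : (T : CommutativeRing c ℓ₁) {κT : K.Carrier → CommutativeRing.Carrier T} →
               AlgebraHom algebra T κT → Vector (CommutativeRing.Carrier T) j → Set ℓ₁
    SolvesAt T {κT} φ y = Solves M T κT (fill k (AlgebraHom.⟦_⟧ φ ∘ chosen) y) (AlgebraHom.⟦_⟧ φ ∘ z)

    -- No point of the open set ρ ≠ 0 has a solution. The negation, density of the solvable points,
    -- is the invariant of the construction.
    Unsolvable : Set (c ⊔ ℓ₁)
    Unsolvable = ∃[ ρ ] ¬ (ρ ≈ 0#) × (∀ (χ : Point algebra) → ¬ (AlgebraHom.⟦_⟧ χ ρ K.≈ K.0#) → ∀ y → ¬ SolvesAt K χ y)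

    Solution : Set (c ⊔ ℓ₁)
    Solution = Σ[ φ ∈ Germ algebra z w ] ∃[ y ] SolvesAt P (Germ.algebraHom φ) y

  module NoUnknowns {k} (M : PolynomialMap F (k +ʳ 0) m) (D : GenericDomain w) (chosen : Vector (GenericDomain.Carrier D) k)
                    (solvable : ¬ Unsolvable {k} {0} M D chosen) where
    open GenericDomain D

    lhs rhs : Fin m → Carrier
    lhs i = substitute F (CommutativeRing.rawRing ring) ι.⟦_⟧ (M i) (fill k chosen (λ ()))
    rhs i = substitute F (CommutativeRing.rawRing ring) ι.⟦_⟧ (L i) z

    module _ {T : CommutativeRing c ℓ₁} {κT : K.Carrier → CommutativeRing.Carrier T} (φ : AlgebraHom algebra T κT) where
      private
        module T = CommutativeRing T
      open AlgebraHom φ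

      lhs-homo : ∀ {y} i → ⟦ lhs i ⟧ T.≈ substitute F T.rawRing κT (M i) (fill k (⟦_⟧ ∘ chosen) y)
      lhs-homo i = substitute-homo F T hom ι.⟦_⟧ κT commutes (M i)
        (fill-pointwise (λ x y → ⟦ x ⟧ T.≈ y) k (λ _ → T.refl) λ ())

      rhs-homo : ∀ i → ⟦ rhs i ⟧ T.≈ substitute F T.rawRing κT (L i) (⟦_⟧ ∘ z)
      rhs-homo i = substitute-homo F T hom ι.⟦_⟧ κT commutes (L i) (λ _ → T.refl)

    -- If an equation failed in R, the difference of its sides would be a nonzero element that
    -- vanishes at every solvable point, and so would witness unsolvability.
    holds : ∀ i → lhs i ≈ rhs i
    holds i with lhs i ≟ rhs i
    ... | yes e = e
    ... | no ≉ = ⊥-elim (solvable (lhs i - rhs i , (λ e → ≉ (x∙y⁻¹≈ε⇒x≈y _ _ e)) , λ χ χρ≉0 y s → χρ≉0 (begin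
        AlgebraHom.⟦_⟧ χ (lhs i - rhs i)
          ≈⟨ K.trans (AlgebraHom.+-homo χ _ _) (K.+-congˡ (AlgebraHom.-‿homo χ _)) ⟩
        AlgebraHom.⟦_⟧ χ (lhs i) K.- AlgebraHom.⟦_⟧ χ (rhs i)
          ≈⟨ K.+-congʳ (K.trans (lhs-homo {K} χ {y} i) (K.trans (s i) (K.sym (rhs-homo {K} χ i)))) ⟩
        AlgebraHom.⟦_⟧ χ (rhs i) K.- AlgebraHom.⟦_⟧ χ (rhs i)
          ≈⟨ K.-‿inverseʳ _ ⟩
        K.0# ∎)))
      where
      open RingProperties (CommutativeRing.ring ring) using (x∙y⁻¹≈ε⇒x≈y)
      open SetoidReasoning K.setoid

    solution : Solution {k} {0} M D chosen
    solution = let φ , _ = dense 1# (IsDomain.1≉0 isDomain) in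
      φ , (λ ()) , λ i → P.trans (P.sym (lhs-homo {P} (Germ.algebraHom φ) i))
        (P.trans (Germ.⟦⟧-cong φ (holds i)) (rhs-homo {P} (Germ.algebraHom φ) i))

  module NextUnknown {k j} (M : PolynomialMap F (k +ʳ suc j) m) (D : GenericDomain w) (chosen : Vector (GenericDomain.Carrier D) k)
                     (solvable : ¬ Unsolvable {k} {suc j} M D chosen) where
    open GenericDomain D
    open Poly

    -- This is unsolvability of the system enlarged by f(y) = 0, where y is the next unknown.
    NeverRoot : Poly.Poly → Set (c ⊔ ℓ₁)
    NeverRoot f = ∃[ ρ ] ¬ (ρ ≈ 0#) × (∀ (χ : Point algebra) → ¬ (AlgebraHom.⟦_⟧ χ ρ K.≈ K.0#) → ∀ y →
                    SolvesAt {k} {suc j} M D chosen K χ y → ¬ (eval K (AlgebraHom.⟦_⟧ χ) (y zero) f K.≈ K.0#))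

    MinimalRoot : Set (c ⊔ ℓ₁)
    MinimalRoot = ∃[ d ] ∃[ h ] ¬ (h ≈ₚ []) × Below (suc d) h × ¬ NeverRoot h ×
                    (∀ f → ¬ (f ≈ₚ []) → Below d f → NeverRoot f)

    -- The least number principle: the first degree bound that admits an exception would make that
    -- exception a `MinimalRoot`.
    minimal-root : ¬ MinimalRoot → ∀ d f → ¬ (f ≈ₚ []) → Below d f → NeverRoot f
    minimal-root none zero    f f≉0 f<d = ⊥-elim (f≉0 (Below-zero f<d))
    minimal-root none (suc d) f f≉0 f<d with em {NeverRoot f}
    ... | yes never = never
    ... | no ¬never = ⊥-elim (none (d , f , f≉0 , f<d , ¬never , minimal-root none d))

    chosenX : Vector Poly.Poly (suc k)
    chosenX = X Vector.∷ (constantₚ ∘ chosen)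

    module _ {T : CommutativeRing c ℓ₁} {κT : K.Carrier → CommutativeRing.Carrier T} where
      private
        module T = CommutativeRing T

      solves-extend : (φ : AlgebraHom algebra T κT) (y : Vector T.Carrier (suc j)) → SolvesAt {k} {suc j} M D chosen T φ y →
                      Solves M T κT (fill (suc k) (AlgebraHom.⟦_⟧ (extend {algebra} φ (y zero)) ∘ chosenX) (y ∘ suc))
                                    (AlgebraHom.⟦_⟧ (extend {algebra} φ (y zero)) ∘ constantₚ ∘ z)
      solves-extend φ y = Solves-cong M T κT
        (fill-pointwise T._≈_ k (λ i → T.sym (eval-constant {T = T} φ.hom (y zero) (chosen i)))
          λ { zero → T.sym (eval-X {T = T} φ.hom (y zero)) ; (suc i) → T.refl })
        (λ i → T.sym (eval-constant {T = T} φ.hom (y zero) (z i)))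
        where module φ = AlgebraHom φ

    module NoMinimalRoot (none : ¬ MinimalRoot) where
      D′ : GenericDomain w
      D′ = Transcendental.transcendental D

      -- A witness f is a nonzero polynomial, hence generically not a root at solutions over R. Such
      -- a solution gives a point of R[X], with X sent to its first entry, at which f is nonzero and
      -- the system is solved by the other entries.
      solvable′ : ¬ Unsolvable {suc k} {j} M D′ chosenX
      solvable′ (f , f≉0 , unsolved) with minimal-root none (List.length f) f f≉0 (Below-length f)
      ... | ρ , ρ≉0 , never = solvable (ρ , ρ≉0 , λ χ χρ≉0 y s →
        unsolved (extend {algebra} χ (y zero)) (never χ χρ≉0 y s) (y ∘ suc) (solves-extend {K} χ y s))

      solution : Solution {suc k} {j} M D′ chosenX → Solution {k} {suc j} M D chosen
      solution (φ , y , s) = record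
        { algebraHom = restrict {algebra} φ.algebraHom
        ; centre     = φ.centre
        ; translates = φ.translates
        } , (φ.⟦ X ⟧ Vector.∷ y) , s
        where module φ = Germ φ

    module LeastRoot (d : ℕ) (h : Poly.Poly) (h≉0 : ¬ (h ≈ₚ [])) (h<d : Below (suc d) h) (recurs : ¬ NeverRoot h)
                     (never : ∀ f → ¬ (f ≈ₚ []) → Below d f → NeverRoot f) where

      -- Of degree less than d, h would fall under its own minimality; of degree 0, it would be a
      -- constant without roots wherever that constant is nonzero.
      leading : ∃[ e ] d ≡ suc e × DomainPoly.Leading (suc e) h
      leading with DomainPoly.leading-below (suc d) h h<d
      ... | inj₁ h≈0 = ⊥-elim (h≉0 h≈0)
      ... | inj₂ (p , s≤s p≤d , h<p , hₚ≉0) with ℕ.m≤n⇒m<n∨m≡n p≤d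
      ...   | inj₁ p<d = ⊥-elim (recurs (never h h≉0 (Below-≤ h p<d h<p)))
      leading | inj₂ (suc e , _ , lead) | inj₂ ≡.refl = e , ≡.refl , lead
      leading | inj₂ (zero , _ , h<1 , h₀≉0) | inj₂ ≡.refl = ⊥-elim (recurs (coeff h 0 , h₀≉0 , λ χ χh₀≉0 y _ root →
        χh₀≉0 (K.trans (K.sym (K.trans (eval-cong {T = K} (AlgebraHom.hom χ) (y zero) h (constantₚ (coeff h 0)) (Below-one h<1))
          (eval-constant {T = K} (AlgebraHom.hom χ) (y zero) (coeff h 0)))) root)))

    module LeastRootAdjoined (d : ℕ) (h : Poly.Poly) (h-leading : DomainPoly.Leading (suc d) h) (recurs : ¬ NeverRoot h)
                     (never : ∀ f → ¬ (f ≈ₚ []) → Below (suc d) f → NeverRoot f) where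
      open Adjoin algebra isDomain d h h-leading
      open IsDomain isDomain using (*-≉0)
      open PseudoDivision ring using (pseudo-division)
      open RawSemiringDefs (RawRing.rawSemiring (CommutativeRing.rawRing ring)) using (_^_)

      -- By minimality a and b are generically not roots at solutions. Where h splits into them it
      -- could not be a root either, against `recurs`.
      irreducible : Irreducible
      irreducible a b c a≉0 b≉0 a<d b<d c≉0 splits =
        let ρ , ρ≉0 , never-a = never a a≉0 a<d
            σ , σ≉0 , never-b = never b b≉0 b<d
        in recurs (c * (ρ * σ) , *-≉0 c≉0 (*-≉0 ρ≉0 σ≉0) , λ χ χ≉0 y s root →
          Sum.[ never-a χ (nonzero-left {algebra} χ ρ σ (nonzero-right {algebra} χ c (ρ * σ) χ≉0)) y s
              , never-b χ (nonzero-right {algebra} χ ρ σ (nonzero-right {algebra} χ c (ρ * σ) χ≉0)) y s ]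
            (splits χ (nonzero-left {algebra} χ c (ρ * σ) χ≉0) (y zero) root))

      open Algebraic D d h h-leading irreducible using (algebraic; extend-point; eval-remainder; remainder-≉0)

      -- The remainder of a witness f modulo h is nonzero of smaller degree, hence generically
      -- nonzero at solutions. Where h(y) = 0 it is a multiple of f(y), so f is nonzero there too.
      solvable′ : ¬ Unsolvable {suc k} {j} M algebraic chosenX
      solvable′ (f , f∉I , unsolved) =
        let e , q , r , r<d , eq = pseudo-division (suc d) h (proj₁ h-leading) f
            ρ , ρ≉0 , never-r = never r (remainder-≉0 {f} e q r (λ f∈I → f∉I (I⇒≈0 f∈I)) eq) r<d
        in recurs (l * ρ , *-≉0 l≉0 ρ≉0 , λ χ χ≉0 y s root →
          unsolved (extend-point χ (y zero) root (nonzero-left {algebra} χ l ρ χ≉0))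
            (λ f≈0 → never-r χ (nonzero-right {algebra} χ l ρ χ≉0) y s
              (K.trans (eval-remainder χ (y zero) root (l ^ e) f q r eq) (K.trans (K.*-congˡ f≈0) (K.zeroʳ _))))
            (y ∘ suc) (solves-extend {K} χ y s))
        where
        open QuotientRing polyRing ideal using (I⇒≈0)

      solution : Solution {suc k} {j} M algebraic chosenX → Solution {k} {suc j} M D chosen
      solution (φ , y , s) = record
        { algebraHom = restrict {algebra} (restrict-root φ.algebraHom)
        ; centre     = φ.centre
        ; translates = φ.translates
        } , (φ.⟦ X ⟧ Vector.∷ y) , s
        where module φ = Germ φ

  solve-generically : ∀ k j (M : PolynomialMap F (k +ʳ j) m) (D : GenericDomain w) (chosen : Vector (GenericDomain.Carrier D) k) →
                      ¬ Unsolvable {k} {j} M D chosen → Solution {k} {j} M D chosen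
  solve-generically k zero    M D chosen solvable = NoUnknowns.solution {k} M D chosen solvable
  solve-generically k (suc j) M D chosen solvable = step (em {MinimalRoot})
    where
    open GenericDomain D using (module Poly; module DomainPoly)
    open NextUnknown {k} {j} M D chosen solvable
    adjoin : ∀ d h → ¬ NeverRoot h → (∀ f → ¬ (f Poly.≈ₚ []) → Poly.Below d f → NeverRoot f) →
             (∃[ e ] d ≡ suc e × DomainPoly.Leading (suc e) h) → Solution {k} {suc j} M D chosen
    adjoin _ h recurs never (d , ≡.refl , h-leading) =
      solution (solve-generically (suc k) j M algebraic chosenX solvable′)
      where
      open LeastRootAdjoined d h h-leading recurs never
      open Algebraic D d h h-leading irreducible using (algebraic)
    step : Dec MinimalRoot → Solution {k} {suc j} M D chosen
    step (no none) = solution (solve-generically (suc k) j M D′ chosenX solvable′)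
      where open NoMinimalRoot none
    step (yes (d , h , h≉0 , h<d , recurs , never)) = adjoin d h recurs never (LeastRoot.leading d h h≉0 h<d recurs never)

-- Series in n variables as iterated series in one variable

module SeriesTower {c ℓ₁ ℓ₂} (F : HeytingField c ℓ₁ ℓ₂) (inverse : Invertible₀ (fieldRing F)) where
  private
    K : CommutativeRing c ℓ₁
    K = fieldRing F
    module K = CommutativeRing K
  open Hensel K inverse using (Henselian; henselian-field; henselian-series) renaming (residue to seriesResidue)

  -- Hensel's lemma then concerns one variable at a time. The outermost series variable is the first
  -- one, matching the head of a multi-index.
  tower : ℕ → CommutativeRing c ℓ₁
  tower zero    = K
  tower (suc n) = Series.seriesRing (tower n)

  private
    module T n = CommutativeRing (tower n)

  scalar : ∀ n → RingHomomorphism K.rawRing (T.rawRing n)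
  scalar zero    = identityHom K
  scalar (suc n) = compose (tower (suc n)) (scalar n) (Series.embedding (tower n))

  record Residue (n : ℕ) : Set (lsuc c ⊔ ℓ₁) where
    field
      hom       : RingHomomorphism (T.rawRing n) K.rawRing
      scalar≈id : ∀ a → RingHomomorphism.⟦_⟧ hom (RingHomomorphism.⟦_⟧ (scalar n) a) K.≈ a
      henselian : Henselian (tower n) hom

  residue : ∀ n → Residue n
  residue zero    = record { hom = identityHom K ; scalar≈id = λ _ → K.refl ; henselian = henselian-field }
  residue (suc n) = record
    { hom       = seriesResidue {tower n} {Residue.hom (residue n)} (Residue.henselian (residue n))
    ; scalar≈id = Residue.scalar≈id (residue n)
    ; henselian = henselian-series {tower n} {Residue.hom (residue n)} (Residue.henselian (residue n))
    }

  curryₛ : ∀ n → PowerSeries F n → T.Carrier n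
  curryₛ zero    f   = f Vec.[]
  curryₛ (suc n) f k = curryₛ n (λ α → f (k Vec.∷ α))

  uncurryₛ : ∀ n → T.Carrier n → PowerSeries F n
  uncurryₛ zero    y Vec.[]      = y
  uncurryₛ (suc n) y (k Vec.∷ α) = uncurryₛ n (y k) α

  curry-uncurry : ∀ n y → T._≈_ n (curryₛ n (uncurryₛ n y)) y
  curry-uncurry zero    y   = K.refl
  curry-uncurry (suc n) y k = curry-uncurry n (y k)

  curry-injective : ∀ n {f g} → T._≈_ n (curryₛ n f) (curryₛ n g) → ∀ α → f α K.≈ g α
  curry-injective zero    e Vec.[]      = e
  curry-injective (suc n) e (k Vec.∷ α) = curry-injective n (e k) α

  curry-cong : ∀ n {f g} → (∀ α → f α K.≈ g α) → T._≈_ n (curryₛ n f) (curryₛ n g)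
  curry-cong zero    e   = e Vec.[]
  curry-cong (suc n) e k = curry-cong n (λ α → e (k Vec.∷ α))

  curry-+ : ∀ n f g → T._≈_ n (curryₛ n (λ α → f α K.+ g α)) (T._+_ n (curryₛ n f) (curryₛ n g))
  curry-+ zero    f g   = K.refl
  curry-+ (suc n) f g k = curry-+ n _ _

  curry-neg : ∀ n f → T._≈_ n (curryₛ n (λ α → K.- f α)) (T.-_ n (curryₛ n f))
  curry-neg zero    f   = K.refl
  curry-neg (suc n) f k = curry-neg n _

  curry-zero : ∀ n → T._≈_ n (curryₛ n (λ _ → K.0#)) (T.0# n)
  curry-zero zero      = K.refl
  curry-zero (suc n) k = curry-zero n

  curry-constant : ∀ n a → T._≈_ n (curryₛ n (constant F a)) (RingHomomorphism.⟦_⟧ (scalar n) a)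
  curry-constant zero    a         = K.refl
  curry-constant (suc n) a zero    = curry-constant n a
  curry-constant (suc n) a (suc k) = curry-zero n

  private
    module S {n} = RawRing (powerSeriesRawRing F n)

    listSum : List K.Carrier → K.Carrier
    listSum = List.foldr K._+_ K.0#

    rangeSum : ℕ → (ℕ → K.Carrier) → K.Carrier
    rangeSum zero    h = K.0#
    rangeSum (suc k) h = h 0 K.+ rangeSum k (h ∘ suc)

    listSum-++ : ∀ xs ys → listSum (xs List.++ ys) K.≈ listSum xs K.+ listSum ys
    listSum-++ []       ys = K.sym (K.+-identityˡ _)
    listSum-++ (x ∷ xs) ys = K.trans (K.+-congˡ (listSum-++ xs ys)) (K.sym (K.+-assoc _ _ _))

    -- `φ` generalises the identity inside `upTo`, because the recursion of `applyUpTo` composes it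
    -- with `suc`.
    listSum-product : ∀ {n} (h : MultiIndex (suc n) → K.Carrier) (φ : ℕ → ℕ) k (βs : List (MultiIndex n)) →
      listSum (List.map h (List.cartesianProductWith Vec._∷_ (List.applyUpTo φ k) βs)) K.≈
      rangeSum k (λ i → listSum (List.map (λ β → h (φ i Vec.∷ β)) βs))
    listSum-product h φ zero    βs = K.refl
    listSum-product h φ (suc k) βs = begin
      listSum (List.map h (List.map (φ 0 Vec.∷_) βs List.++ rest))
        ≡⟨ ≡.cong listSum (map-++ h (List.map (φ 0 Vec.∷_) βs) rest) ⟩
      listSum (List.map h (List.map (φ 0 Vec.∷_) βs) List.++ List.map h rest)
        ≈⟨ listSum-++ (List.map h (List.map (φ 0 Vec.∷_) βs)) (List.map h rest) ⟩
      listSum (List.map h (List.map (φ 0 Vec.∷_) βs)) K.+ listSum (List.map h rest)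
        ≈⟨ K.+-cong (K.reflexive (≡.cong listSum (≡.sym (map-∘ βs)))) (listSum-product h (φ ∘ suc) k βs) ⟩
      rangeSum (suc k) (λ i → listSum (List.map (λ β → h (φ i Vec.∷ β)) βs)) ∎
      where
      open SetoidReasoning K.setoid
      rest : List (MultiIndex _)
      rest = List.cartesianProductWith Vec._∷_ (List.applyUpTo (φ ∘ suc) k) βs

  curry-* : ∀ n f g → T._≈_ n (curryₛ n (f S.* g)) (T._*_ n (curryₛ n f) (curryₛ n g))
  curry-* zero    f g   = K.+-identityʳ _
  curry-* (suc n) f g k = T.trans n
    (curry-cong n (λ α → listSum-product (λ β → f β K.* g (Vec.zipWith ℕ._∸_ (k Vec.∷ α) β)) id (suc k) (below α)))
    (convolution (λ i α → f (i Vec.∷ α)) k)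
    where
    g′ : ℕ → PowerSeries F n
    g′ i α = g (i Vec.∷ α)
    -- The first factor is bound anew because the recursion shifts it. The index k ∸ i is stable
    -- under this shift, as suc k ∸ suc i computes to k ∸ i.
    convolution : ∀ (f : ℕ → PowerSeries F n) k →
      T._≈_ n (curryₛ n (λ α → rangeSum (suc k) (λ i → (f i S.* g′ (k ℕ.∸ i)) α)))
              (Series._⊛_ (tower n) (curryₛ n ∘ f) (curryₛ n ∘ g′) k)
    convolution f zero    = T.trans n (curry-cong n (λ α → K.+-identityʳ _)) (curry-* n (f 0) (g′ 0))
    convolution f (suc k) = T.trans n (curry-+ n _ _) (T.+-cong n (curry-* n (f 0) (g′ (suc k))) (convolution (f ∘ suc) k))

  currying : ∀ n → RingHomomorphism (powerSeriesRawRing F n) (T.rawRing n)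
  currying n = record
    { ⟦_⟧ = curryₛ n
    ; isRingHomomorphism = record
      { isSemiringHomomorphism = record
        { isNearSemiringHomomorphism = record
          { +-isMonoidHomomorphism = record
            { isMagmaHomomorphism = record
              { isRelHomomorphism = record { cong = curry-cong n } ; homo = curry-+ n }
            ; ε-homo = T.trans n (curry-constant n K.0#) (RingHomomorphism.0#-homo (scalar n))
            }
          ; *-homo = curry-* n
          }
        ; 1#-homo = T.trans n (curry-constant n K.1#) (RingHomomorphism.1#-homo (scalar n))
        }
      ; -‿homo = curry-neg n
      }
    }

-- From a generic solution to the identity of power series

theorem1p14 : ∀ {c ℓ₁ ℓ₂} → ExcludedMiddle (c ⊔ ℓ₁ ⊔ ℓ₂) →
    (F : HeytingField c ℓ₁ ℓ₂) → AlgebraicallyClosed F → CharacteristicZero F →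
    (n m r : ℕ) (L : PolynomialMap F n m) (M : PolynomialMap F r m) →
    im F L ⊆ im F M →
    Σ[ a ∈ Vector (HeytingField.Carrier F) n ] Σ[ p ∈ Vector (PowerSeries F n) r ]
    _≈ₛ_ F (applySeries F L (translate F a)) (applySeries F M p)
theorem1p14 {c} {ℓ₁} {ℓ₂} em F closed char0 n m r L M L⊆M = Germ.centre φ , uncurryₛ n ∘ y , equation
  where
  em₁ : ExcludedMiddle (c ⊔ ℓ₁)
  em₁ {A} = map′ lower lift (em {Lift ℓ₂ A})

  em₂ : ExcludedMiddle ℓ₂
  em₂ {A} = map′ lower lift (em {Lift (c ⊔ ℓ₁) A})

  inverse : Invertible₀ (fieldRing F)
  inverse = FieldProperties.inverse F em₁ em₂

  open SeriesTower F inverse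
  open Residue (residue n)
  module K = CommutativeRing (fieldRing F)
  module T = CommutativeRing (tower n)

  w : Vector T.Carrier n
  w i = curryₛ n (variable-series F i)

  open Algebras F em₁
  open Germs F em₁ inverse closed char0 (tower n) (scalar n) hom scalar≈id henselian renaming (residue to residuePoint)
  open Elimination F em₁ inverse closed char0 (tower n) (scalar n) hom scalar≈id henselian w L

  D : GenericDomain w
  D = polynomials n w
  open GenericDomain D using (z; dense; algebra)

  solvable : ¬ Unsolvable {0} {r} M D (λ ())
  solvable (ρ , ρ≉0 , unsolved) =
    let φ , φρ≉0 = dense ρ ρ≉0
        χ = residuePoint {algebra} (Germ.algebraHom φ)
        -- The inclusion of images makes the system solvable over every point, so one point with ρ
        -- nonzero is already a contradiction.
        y , s = L⊆M (AlgebraHom.⟦_⟧ χ ∘ z , λ _ → K.refl)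
    in unsolved χ φρ≉0 y s

  solution : Solution {0} {r} M D (λ ())
  solution = solve-generically 0 r M D (λ ()) solvable

  φ : Germ algebra z w
  φ = proj₁ solution

  y : Vector T.Carrier r
  y = proj₁ (proj₂ solution)

  equation : _≈ₛ_ F (applySeries F L (translate F (Germ.centre φ))) (applySeries F M (uncurryₛ n ∘ y))
  -- After currying, z + c is the image of the coordinates under the germ, so that the left side is
  -- the right-hand side of the solved system.
  equation j = curry-injective n (T.trans
    (substitute-homo F (tower n) (currying n) (constant F) (RingHomomorphism.⟦_⟧ (scalar n)) (curry-constant n) (L j)
      (λ i → T.trans (curry-+ n _ _) (T.trans (T.+-congˡ (curry-constant n _)) (T.sym (Germ.translates φ i)))))
    (T.trans (T.sym (proj₂ (proj₂ solution) j))
      (T.sym (substitute-homo F (tower n) (currying n) (constant F) (RingHomomorphism.⟦_⟧ (scalar n)) (curry-constant n) (M j)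
        (λ i → curry-uncurry n (y i))))))
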